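{- Let $G$ be a diamond-free graph. Then $G$ is clique-perfect if and only if no induced subgraph of $G$ is an odd hole or a sunoid.
   Context: Graphs are finite and simple. The diamond is $K_4$ minus an edge; diamond-free means no induced diamond. A hole is an induced cycle of length at least 4, odd if its length is odd. A clique-transversal of $G$ is a vertex set meeting every maximal clique; $\tau_c(G)$ is its minimum size. A clique-independent set is a collection of pairwise vertex-disjoint maximal cliques; $\alpha_c(G)$ is its maximum size. $G$ is clique-perfect if $\tau_c(G')=\alpha_c(G')$ for every induced subgraph $G'$ of $G$. Multisun: a diamond-free graph of odd order whose maximal cliques of size 2 span a Hamiltonian cycle $C$ (the rim); all other maximal cliques consist of pairwise nonconsecutive vertices of $C$ and are the inscribed cliques. A sub-multisun is obtained by deleting the edge sets of some, but not all, inscribed cliques. For inscribed cliques $A,B$ (possibly equal), an $AB$-path is a rim subpath with one endpoint in $A$, the other in $B$, and no internal vertex in any inscribed clique; an $A$-path is an $AA$-path; for $v\in B$ an $Av$-path is an $AB$-path ending at $v$ in $B$. N-conditions: (N1) every $A$-path has an even number of vertices, at least four; (N2) every inscribed clique has odd size; (N3) all inscribed cliques share one vertex $\xi$ and are otherwise pairwise disjoint; (N4) every $A\xi$-path has an even number of vertices; (N5) every $AB$-path with $A\ne B$ has an odd number of vertices. A sunoid is a multisun such that it and each of its sub-multisuns satisfy the N-conditions.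
   Formalization: In (N5), AB-paths with A ≠ B are taken with one endpoint in A but not B and the other in B but not A, so paths ending at ξ are excluded; read literally, (N5) contradicts (N4) whenever there are two inscribed cliques. -}

module Defs where

open import Data.Nat using (ℕ; zero; suc; _+_; _*_; _≤_; _<_)
open import Data.Bool using (Bool; true; false; _∧_; not)
open import Data.Bool.Properties using (∧-comm)
open import Data.Fin using (Fin; toℕ; fromℕ) renaming (zero to fzero)
open import Data.Fin.Subset using (Subset; _∈_; _∉_; _⊆_; ∣_∣; Nonempty; ⁅_⁆; _∪_)
open import Data.Vec using (lookup)
open import Data.List using (List; []; _∷_; length)
open import Data.Bool.ListAction using (any)
open import Data.List.Relation.Unary.All using (All)
open import Data.List.Relation.Unary.Any using (Any)
open import Data.List.Relation.Unary.AllPairs using (AllPairs)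
open import Data.Product using (Σ; ∃; ∃-syntax; _×_; _,_)
open import Data.Sum using (_⊎_)
open import Data.Empty using (⊥)
open import Function.Definitions using (Injective)
open import Relation.Nullary using (¬_)
open import Relation.Binary.PropositionalEquality using (_≡_; _≢_; refl; cong₂)

Even : ℕ → Set
Even m = ∃[ k ] m ≡ 2 * k

Odd : ℕ → Set
Odd m = ∃[ k ] m ≡ suc (2 * k)

record Graph (n : ℕ) : Set where
  field
    adj    : Fin n → Fin n → Bool
    sym    : ∀ i j → adj i j ≡ adj j i
    irrefl : ∀ i → adj i i ≡ false

open Graph public

Edge : ∀ {n} → Graph n → Fin n → Fin n → Set
Edge G i j = adj G i j ≡ true

induced : ∀ {m n} → Graph n → (Fin m → Fin n) → Graph m
induced G f = record
  { adj = λ i j → adj G (f i) (f j)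
  ; sym = λ i j → sym G (f i) (f j)
  ; irrefl = λ i → irrefl G (f i) }

_≼ᵢ_ : ∀ {m n} → Graph m → Graph n → Set
_≼ᵢ_ {m} {n} H G =
  Σ (Fin m → Fin n) λ f → Injective _≡_ _≡_ f × (∀ i j → adj H i j ≡ adj G (f i) (f j))

IsClique : ∀ {n} → Graph n → Subset n → Set
IsClique G S = ∀ x y → x ∈ S → y ∈ S → x ≢ y → Edge G x y

IsMaxClique : ∀ {n} → Graph n → Subset n → Set
IsMaxClique G S =
  IsClique G S × Nonempty S × (∀ T → IsClique G T → S ⊆ T → T ⊆ S)

IsCliqueTransversal : ∀ {n} → Graph n → Subset n → Set
IsCliqueTransversal G T = ∀ K → IsMaxClique G K → ∃[ x ] (x ∈ T × x ∈ K)

Disjoint : ∀ {n} → Subset n → Subset n → Set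
Disjoint A B = ∀ x → x ∈ A → x ∈ B → ⊥

IsCliqueIndependent : ∀ {n} → Graph n → List (Subset n) → Set
IsCliqueIndependent G Ks = All (IsMaxClique G) Ks × AllPairs Disjoint Ks

τc≡ : ∀ {n} → Graph n → ℕ → Set
τc≡ G k =
  (∃[ T ] (IsCliqueTransversal G T × ∣ T ∣ ≡ k)) ×
  (∀ T → IsCliqueTransversal G T → k ≤ ∣ T ∣)

αc≡ : ∀ {n} → Graph n → ℕ → Set
αc≡ G k =
  (∃[ Ks ] (IsCliqueIndependent G Ks × length Ks ≡ k)) ×
  (∀ Ks → IsCliqueIndependent G Ks → length Ks ≤ k)

CliquePerfect : ∀ {n} → Graph n → Set
CliquePerfect {n} G =
  ∀ m (f : Fin m → Fin n) → Injective _≡_ _≡_ f →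
  ∃[ k ] (τc≡ (induced G f) k × αc≡ (induced G f) k)

IsInducedDiamond : ∀ {n} → Graph n → Fin n → Fin n → Fin n → Fin n → Set
IsInducedDiamond G a b c d =
  a ≢ b × ¬ Edge G a b × Edge G c d ×
  Edge G a c × Edge G a d × Edge G b c × Edge G b d

DiamondFree : ∀ {n} → Graph n → Set
DiamondFree G = ∀ a b c d → ¬ IsInducedDiamond G a b c d

RimSucc : (n : ℕ) → Fin n → Fin n → Set
RimSucc n i j = (toℕ j ≡ suc (toℕ i)) ⊎ (suc (toℕ i) ≡ n × toℕ j ≡ 0)

RimAdj : (n : ℕ) → Fin n → Fin n → Set
RimAdj n i j = RimSucc n i j ⊎ RimSucc n j i

HasInducedOddHole : ∀ {n} → Graph n → Set
HasInducedOddHole {n} G =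
  ∃[ k ] (Odd k × 4 ≤ k ×
    Σ (Fin k → Fin n) λ f → Injective _≡_ _≡_ f ×
      (∀ i j → (Edge G (f i) (f j) → RimAdj k i j) × (RimAdj k i j → Edge G (f i) (f j))))

-- Multisuns.  The vertices are labelled along the rim, i.e. the rim is
-- the standard cycle 0 - 1 - ... - (n-1) - 0.

IsMultisun : ∀ {n} → Graph n → Set
IsMultisun {n} H =
  DiamondFree H × Odd n × 3 ≤ n ×
  (∀ x y → x ≢ y →
     (IsMaxClique H (⁅ x ⁆ ∪ ⁅ y ⁆) → RimAdj n x y) ×
     (RimAdj n x y → IsMaxClique H (⁅ x ⁆ ∪ ⁅ y ⁆))) ×
  (∀ K → IsMaxClique H K → ∣ K ∣ ≢ 2 →
     ∀ x y → x ∈ K → y ∈ K → ¬ RimAdj n x y)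

Inscribed : ∀ {n} → Graph n → Subset n → Set
Inscribed H K = IsMaxClique H K × ∣ K ∣ ≢ 2

inSome : ∀ {n} → List (Subset n) → Fin n → Fin n → Bool
inSome D x y = any (λ K → lookup K x ∧ lookup K y) D

inSome-sym : ∀ {n} (D : List (Subset n)) x y → inSome D x y ≡ inSome D y x
inSome-sym [] x y = refl
inSome-sym (K ∷ D) x y =
  cong₂ Data.Bool._∨_ (∧-comm (lookup K x) (lookup K y)) (inSome-sym D x y)

deleteCliques : ∀ {n} → Graph n → List (Subset n) → Graph n
deleteCliques H D = record
  { adj = λ x y → adj H x y ∧ not (inSome D x y)
  ; sym = λ x y → cong₂ _∧_ (sym H x y) (Relation.Binary.PropositionalEquality.cong not (inSome-sym D x y))
  ; irrefl = λ x → Relation.Binary.PropositionalEquality.cong (_∧ not (inSome D x x)) (irrefl H x) }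

-- Rim subpaths (traversed in rim order; every rim subpath is such a path
-- or the reverse of one).  The path has 2 + k vertices, k of them internal.

record RimPath (n : ℕ) : Set where
  field
    k    : ℕ
    vtx  : Fin (2 + k) → Fin n
    inj  : Injective _≡_ _≡_ vtx
    step : ∀ (s t : Fin (2 + k)) → suc (toℕ s) ≡ toℕ t → RimSucc n (vtx s) (vtx t)

  nverts : ℕ
  nverts = 2 + k

  start : Fin n
  start = vtx fzero

  end : Fin n
  end = vtx (fromℕ (suc k))

  Internal : Fin n → Set
  Internal v = ∃[ t ] (0 < toℕ t × toℕ t < suc k × vtx t ≡ v)

open RimPath public

Clean : ∀ {n} → Graph n → RimPath n → Set
Clean H P = ∀ v → Internal P v → ∀ K → Inscribed H K → v ∉ K

Joins : ∀ {n} → RimPath n → (Fin n → Set) → (Fin n → Set) → Set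
Joins P X Y = (X (start P) × Y (end P)) ⊎ (Y (start P) × X (end P))

N1 : ∀ {n} → Graph n → Set
N1 H = ∀ A → Inscribed H A → ∀ P → Clean H P → Joins P (_∈ A) (_∈ A) →
       Even (nverts P) × 4 ≤ nverts P

N2 : ∀ {n} → Graph n → Set
N2 H = ∀ A → Inscribed H A → Odd ∣ A ∣

N3 : ∀ {n} → Graph n → Fin n → Set
N3 H ξ = (∀ A → Inscribed H A → ξ ∈ A) ×
         (∀ A B → Inscribed H A → Inscribed H B → A ≢ B → ∀ x → x ∈ A → x ∈ B → x ≡ ξ)

N4 : ∀ {n} → Graph n → Fin n → Set
N4 H ξ = ∀ A → Inscribed H A → ∀ P → Clean H P → Joins P (_∈ A) (_≡ ξ) →
         Even (nverts P)

N5 : ∀ {n} → Graph n → Set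
N5 H = ∀ A B → Inscribed H A → Inscribed H B → A ≢ B →
       ∀ P → Clean H P → Joins P (λ v → v ∈ A × v ∉ B) (λ v → v ∈ B × v ∉ A) →
       Odd (nverts P)

NConditions : ∀ {n} → Graph n → Set
NConditions H = N1 H × N2 H × (∃[ ξ ] (N3 H ξ × N4 H ξ)) × N5 H

IsSunoid : ∀ {n} → Graph n → Set
IsSunoid H =
  IsMultisun H × NConditions H ×
  (∀ D → All (Inscribed H) D → (∃[ K ] (Inscribed H K × ¬ Any (K ≡_) D)) →
     NConditions (deleteCliques H D))

HasInducedSunoid : ∀ {n} → Graph n → Set
HasInducedSunoid G = ∃[ m ] Σ (Graph m) λ H → IsSunoid H × H ≼ᵢ G

{-# OPTIONS --safe #-}
-- If the rim edges of an odd cycle on m vertices are maximal cliques, a transversal has at least m/2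
-- vertices and disjoint maximal cliques number at most m/2; since m is odd, τ and α differ. This excludes
-- odd holes and multisuns from clique-perfect graphs.
--
-- Conversely, call an odd cycle proper if no edge of it lies in a triangle with another vertex of the cycle.
-- In a diamond-free graph an edge determines its maximal clique, so the absence of proper odd cycles says
-- that the hypergraph of maximal cliques is balanced. Balancedness bicolours every family of cliques (dually),
-- hence colours its members with maximum-degree many colours (Berge), and Lovász's argument gives τ = α.
--
-- A shortest proper odd cycle C spans a sunoid. A chord in a clique A which closes an A-segment of even length
-- is a shortcut, so all A-segments are odd: (N1), (N2), (N4). If A and B share ξ, an odd path from A to B closes
-- up through ξ: (N5). Diamond-freeness makes pairwise intersecting cliques share one vertex: (N3). If A and B were
-- disjoint, closing up two disjoint rim paths from A to B with one chord of each clique shows that their lengths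
-- have the same parity, and walking once around C contradicts the oddness of m. All these facts concern
-- pairs of inscribed cliques of C only, so they pass to the sub-multisuns.
module Submission where

open import Defs
open import Data.Bool using (Bool; true; false; not; _∧_)
import Data.Bool.Properties as Bool
open import Data.Empty using (⊥; ⊥-elim)
open import Data.Fin using (Fin; zero; suc; toℕ; fromℕ<; inject≤; punchOut; combine; remQuot)
open import Data.Fin.Properties as Fin using (toℕ-injective; toℕ<n; toℕ-fromℕ<; any?; all?; injective⇒≤)
open import Data.Fin.Subset using (Subset; _∈_; _∉_; _⊆_; ∣_∣; Nonempty; ⁅_⁆; _∪_; _-_; ⊤) renaming (⊥ to ∅)
open import Data.Fin.Subset.Properties as Subset
  using (_∈?_; _⊆?_; x∈⁅x⁆; x∈⁅y⁆⇒x≡y; x∈p∪q⁺; x∈p∪q⁻; anySubset?; ⊆-antisym)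
open import Data.List using (List; []; _∷_; _++_; length; lookup; map; filter; reverse; applyUpTo; tabulate; allFin)
import Data.List.Properties as List
open import Data.List.Membership.Propositional using () renaming (_∈_ to _∈ˡ_; _∉_ to _∉ˡ_)
open import Data.List.Membership.Propositional.Properties as ∈ˡ using (∈-lookup; ∈-++⁻)
import Data.List.Relation.Binary.Permutation.Setoid as Permutation
import Data.List.Relation.Binary.Permutation.Setoid.Properties as Permutation
open import Data.List.Relation.Unary.All as All using (All; []; _∷_)
import Data.List.Relation.Unary.All.Properties as All
open import Data.List.Relation.Unary.Any as Any using (Any; here; there)
import Data.List.Relation.Unary.Any.Properties as Any
open import Data.List.Relation.Unary.AllPairs using (AllPairs; []; _∷_)
import Data.List.Relation.Unary.AllPairs.Properties as AllPairs
open import Data.List.Relation.Unary.Unique.Propositional using (Unique)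
import Data.List.Relation.Unary.Unique.Propositional.Properties as Unique
open import Data.Nat using (ℕ; zero; suc; _+_; _*_; _∸_; _≤_; _<_; z≤n; s≤s; NonZero; >-nonZero; >-nonZero⁻¹; parity; _≤?_; _<?_)
open import Data.Nat.DivMod using (_%_; _/_; _mod_; m%n<n; m≡m%n+[m/n]*n; [m+n]%n≡m%n; [m+kn]%n≡m%n; m<n⇒m%n≡m; n%n≡0)
import Data.Nat.Properties as ℕ
open import Data.Parity.Base as ℙ using (Parity; 0ℙ; 1ℙ; _⁻¹)
import Data.Parity.Properties as ℙ
open import Data.Product using (Σ; ∃-syntax; ∃₂; _×_; _,_; proj₁; proj₂)
open import Data.Sum as Sum using (_⊎_; inj₁; inj₂)
import Data.Vec as Vec
open import Data.Vec using ([]; _∷_)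
import Data.Vec.Properties as Vec
open import Function using (_∘_; id; case_of_)
open import Function.Definitions using (Injective)
open import Relation.Binary.Definitions using (tri<; tri≈; tri>)
open import Relation.Binary.PropositionalEquality using (_≡_; _≢_; refl; trans; cong; cong₂; subst; setoid; module ≡-Reasoning) renaming (sym to ≡-sym)
open import Relation.Nullary using (¬_; Dec; yes; no; does; contradiction)
open import Relation.Nullary.Decidable using (decidable-stable; dec-true; map′; ¬?; _×-dec_; _→-dec_; _⊎-dec_)
open import Relation.Unary using (Decidable)

private
  variable
    m n : ℕ

-- Finite sets and maximal cliques of diamond-free graphs

lookup-injective : ∀ {A : Set} {xs : List A} → Unique xs → Injective _≡_ _≡_ (lookup xs)
lookup-injective (x∉ ∷ u) {zero}  {zero}  eq = refl
lookup-injective (x∉ ∷ u) {zero}  {suc j} eq = contradiction eq (All.lookup x∉ (∈-lookup j))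
lookup-injective (x∉ ∷ u) {suc i} {zero}  eq = contradiction (≡-sym eq) (All.lookup x∉ (∈-lookup i))
lookup-injective (x∉ ∷ u) {suc i} {suc j} eq = cong suc (lookup-injective u eq)

unique⇒length≤∣∣ : ∀ {xs : List (Fin n)} (S : Subset n) → Unique xs → All (_∈ S) xs → length xs ≤ ∣ S ∣
unique⇒length≤∣∣ S [] [] = z≤n
unique⇒length≤∣∣ {xs = x ∷ xs} S (x∉ ∷ u) (x∈S ∷ xs⊆S) =
  ℕ.<-≤-trans (s≤s (unique⇒length≤∣∣ (S - x) u xs⊆S-x)) (Subset.x∈p⇒∣p-x∣<∣p∣ x∈S)
  where
  xs⊆S-x : All (_∈ S - x) xs
  xs⊆S-x = All.tabulate λ y∈xs →
    Subset.x∈p∧x≢y⇒x∈p-y (All.lookup xs⊆S y∈xs) λ y≡x → All.lookup x∉ y∈xs (≡-sym y≡x)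

unique⇒length≤ : ∀ {xs : List (Fin n)} → Unique xs → length xs ≤ n
unique⇒length≤ {xs = xs} u = injective⇒≤ (lookup-injective u)

unique⇒length< : ∀ {xs : List (Fin n)} {x} → Unique xs → x ∉ˡ xs → length xs < n
unique⇒length< u x∉ = unique⇒length≤ (All.tabulate (λ y∈ x≡y → x∉ (subst (_∈ˡ _) (≡-sym x≡y) y∈)) ∷ u)

∣p∪q∣≤∣p∣+∣q∣ : (p q : Subset n) → ∣ p ∪ q ∣ ≤ ∣ p ∣ + ∣ q ∣
∣p∪q∣≤∣p∣+∣q∣ []          []          = z≤n
∣p∪q∣≤∣p∣+∣q∣ (false ∷ p) (false ∷ q) = ∣p∪q∣≤∣p∣+∣q∣ p q
∣p∪q∣≤∣p∣+∣q∣ (false ∷ p) (true  ∷ q) = ℕ.≤-trans (s≤s (∣p∪q∣≤∣p∣+∣q∣ p q)) (ℕ.≤-reflexive (≡-sym (ℕ.+-suc ∣ p ∣ ∣ q ∣)))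
∣p∪q∣≤∣p∣+∣q∣ (true  ∷ p) (false ∷ q) = s≤s (∣p∪q∣≤∣p∣+∣q∣ p q)
∣p∪q∣≤∣p∣+∣q∣ (true  ∷ p) (true  ∷ q) =
  s≤s (ℕ.≤-trans (∣p∪q∣≤∣p∣+∣q∣ p q) (ℕ.+-monoʳ-≤ ∣ p ∣ (ℕ.n≤1+n ∣ q ∣)))

-- Removing a member lowers the size, yet removing `x` a second time changes nothing.
x∉p-x : ∀ {p : Subset n} {x} → x ∉ p - x
x∉p-x {p = p} {x} x∈ =
  ℕ.<⇒≢ (Subset.x∈p⇒∣p-x∣<∣p∣ x∈) (cong ∣_∣ (Subset.p─q─q≡p─q p ⁅ x ⁆))

length-filter-¬ : ∀ {A : Set} {P : A → Set} (P? : Decidable P) xs →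
  length xs ≡ length (filter P? xs) + length (filter (¬? ∘ P?) xs)
length-filter-¬ P? [] = refl
length-filter-¬ P? (x ∷ xs) with P? x
... | yes _ = cong suc (length-filter-¬ P? xs)
... | no  _ = trans (cong suc (length-filter-¬ P? xs)) (≡-sym (ℕ.+-suc _ _))

allSubset? : ∀ {P : Subset n → Set} → Decidable P → Dec (∀ S → P S)
allSubset? P? with anySubset? (¬? ∘ P?)
... | yes (S , ¬PS) = no λ ∀P → ¬PS (∀P S)
... | no  ∄¬P       = yes λ S → decidable-stable (P? S) λ ¬PS → ∄¬P (S , ¬PS)

pair-members : ∀ {x y z : Fin n} → z ∈ ⁅ x ⁆ ∪ ⁅ y ⁆ → z ≡ x ⊎ z ≡ y
pair-members z∈ = Sum.map (x∈⁅y⁆⇒x≡y _) (x∈⁅y⁆⇒x≡y _) (x∈p∪q⁻ _ _ z∈)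

x∈⁅x,y⁆ : ∀ {x y : Fin n} → x ∈ ⁅ x ⁆ ∪ ⁅ y ⁆
x∈⁅x,y⁆ {x = x} = x∈p∪q⁺ (inj₁ (x∈⁅x⁆ x))

y∈⁅x,y⁆ : ∀ {x y : Fin n} → y ∈ ⁅ x ⁆ ∪ ⁅ y ⁆
y∈⁅x,y⁆ {y = y} = x∈p∪q⁺ (inj₂ (x∈⁅x⁆ y))

pair⊆ : ∀ {x y : Fin n} {S : Subset n} → x ∈ S → y ∈ S → ⁅ x ⁆ ∪ ⁅ y ⁆ ⊆ S
pair⊆ x∈ y∈ z∈ with pair-members z∈
... | inj₁ refl = x∈
... | inj₂ refl = y∈

∣⁅x,y⁆∣≡2 : ∀ {x y : Fin n} → x ≢ y → ∣ ⁅ x ⁆ ∪ ⁅ y ⁆ ∣ ≡ 2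
∣⁅x,y⁆∣≡2 {x = x} {y} x≢y = ℕ.≤-antisym
  (ℕ.≤-trans (∣p∪q∣≤∣p∣+∣q∣ ⁅ x ⁆ ⁅ y ⁆) (ℕ.≤-reflexive (cong₂ _+_ (Subset.∣⁅x⁆∣≡1 x) (Subset.∣⁅x⁆∣≡1 y))))
  (unique⇒length≤∣∣ _ ((x≢y ∷ []) ∷ [] ∷ []) (x∈⁅x,y⁆ ∷ y∈⁅x,y⁆ ∷ []))

Edge? : (G : Graph n) → ∀ x y → Dec (Edge G x y)
Edge? G x y = adj G x y Bool.≟ true

Edge-sym : (G : Graph n) → ∀ {x y} → Edge G x y → Edge G y x
Edge-sym G {x} {y} e = trans (Graph.sym G y x) e

Edge⇒≢ : (G : Graph n) → ∀ {x y} → Edge G x y → x ≢ y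
Edge⇒≢ G {x} e refl with trans (≡-sym e) (irrefl G x)
... | ()

IsClique? : (G : Graph n) → Decidable (IsClique G)
IsClique? G S = all? λ x → all? λ y → (x ∈? S) →-dec (y ∈? S) →-dec ¬? (x Fin.≟ y) →-dec Edge? G x y

IsMaxClique? : (G : Graph n) → Decidable (IsMaxClique G)
IsMaxClique? G S = IsClique? G S ×-dec any? (_∈? S) ×-dec
  allSubset? (λ T → IsClique? G T →-dec (S ⊆? T) →-dec (T ⊆? S))

module _ (G : Graph n) where

  clique-∪ : ∀ {S x} → IsClique G S → (∀ y → y ∈ S → y ≢ x → Edge G y x) → IsClique G (S ∪ ⁅ x ⁆)
  clique-∪ {S} {x} clq ext u v u∈ v∈ u≢v with x∈p∪q⁻ S _ u∈ | x∈p∪q⁻ S _ v∈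
  ... | inj₁ u∈S | inj₁ v∈S = clq u v u∈S v∈S u≢v
  ... | inj₂ u∈x | inj₂ v∈x = contradiction (trans (x∈⁅y⁆⇒x≡y x u∈x) (≡-sym (x∈⁅y⁆⇒x≡y x v∈x))) u≢v
  ... | inj₁ u∈S | inj₂ v∈x with refl ← x∈⁅y⁆⇒x≡y x v∈x = ext u u∈S u≢v
  ... | inj₂ u∈x | inj₁ v∈S with refl ← x∈⁅y⁆⇒x≡y x u∈x = Edge-sym G (ext v v∈S (u≢v ∘ ≡-sym))

  maxClique-absorbs : ∀ {K x} → IsMaxClique G K → (∀ y → y ∈ K → y ≢ x → Edge G y x) → x ∈ K
  maxClique-absorbs {K} {x} (clq , _ , max) ext =
    max (K ∪ ⁅ x ⁆) (clique-∪ clq ext) (λ y∈ → x∈p∪q⁺ (inj₁ y∈)) (x∈p∪q⁺ (inj₂ (x∈⁅x⁆ x)))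

  pair-clique : ∀ {x y} → Edge G x y → IsClique G (⁅ x ⁆ ∪ ⁅ y ⁆)
  pair-clique e u v u∈ v∈ u≢v with pair-members u∈ | pair-members v∈
  ... | inj₁ refl | inj₁ refl = contradiction refl u≢v
  ... | inj₁ refl | inj₂ refl = e
  ... | inj₂ refl | inj₁ refl = Edge-sym G e
  ... | inj₂ refl | inj₂ refl = contradiction refl u≢v

  pair-maxClique : ∀ {x y} → Edge G x y → (∀ w → Edge G w x → Edge G w y → ⊥) → IsMaxClique G (⁅ x ⁆ ∪ ⁅ y ⁆)
  pair-maxClique {x} {y} e none = pair-clique e , (x , x∈⁅x,y⁆) , max
    where
    max : ∀ T → IsClique G T → ⁅ x ⁆ ∪ ⁅ y ⁆ ⊆ T → T ⊆ ⁅ x ⁆ ∪ ⁅ y ⁆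
    max T clq xy⊆T {w} w∈T with w Fin.≟ x | w Fin.≟ y
    ... | yes refl | _        = x∈⁅x,y⁆
    ... | no _     | yes refl = y∈⁅x,y⁆
    ... | no w≢x   | no w≢y   =
      ⊥-elim (none w (clq w x w∈T (xy⊆T x∈⁅x,y⁆) w≢x) (clq w y w∈T (xy⊆T y∈⁅x,y⁆) w≢y))

  maxClique-of-edge : ∀ {x y} → IsMaxClique G (⁅ x ⁆ ∪ ⁅ y ⁆) → x ≢ y → Edge G x y
  maxClique-of-edge (clq , _) = clq _ _ x∈⁅x,y⁆ y∈⁅x,y⁆

  -- Were `x` the only member, its neighbour `y` could be added to `K`.
  maxClique-second : ∀ {K x y} → IsMaxClique G K → x ∈ K → Edge G y x → ∃[ z ] (z ∈ K × z ≢ x)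
  maxClique-second {K} {x} {y} mK x∈ e with any? (λ z → (z ∈? K) ×-dec ¬? (z Fin.≟ x))
  ... | yes r   = r
  ... | no  ∄z = contradiction (y , maxClique-absorbs mK joined , Edge⇒≢ G e) ∄z
    where
    joined : ∀ z → z ∈ K → z ≢ y → Edge G z y
    joined z z∈ _ with z Fin.≟ x
    ... | yes refl = Edge-sym G e
    ... | no z≢x   = contradiction (z , z∈ , z≢x) ∄z

  maxClique-third : ∀ {K x y z} → IsMaxClique G K → ∣ K ∣ ≢ 2 → x ∈ K → y ∈ K → Edge G z x →
    ∃[ w ] (w ∈ K × w ≢ x × w ≢ y)
  maxClique-third {K} {x} {y} mK size x∈ y∈ e
    with any? (λ w → (w ∈? K) ×-dec ¬? (w Fin.≟ x) ×-dec ¬? (w Fin.≟ y)) | x Fin.≟ y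
  ... | yes r  | _        = r
  ... | no  ∄w | yes refl with z , z∈ , z≢x ← maxClique-second mK x∈ e = contradiction (z , z∈ , z≢x , z≢x) ∄w
  ... | no  ∄w | no x≢y   = contradiction (trans (cong ∣_∣ K≡xy) (∣⁅x,y⁆∣≡2 x≢y)) size
    where
    K⊆xy : K ⊆ ⁅ x ⁆ ∪ ⁅ y ⁆
    K⊆xy {w} w∈ with w Fin.≟ x | w Fin.≟ y
    ... | yes refl | _        = x∈⁅x,y⁆
    ... | no _     | yes refl = y∈⁅x,y⁆
    ... | no w≢x   | no w≢y   = contradiction (w , w∈ , w≢x , w≢y) ∄w
    K≡xy : K ≡ ⁅ x ⁆ ∪ ⁅ y ⁆
    K≡xy = ⊆-antisym K⊆xy (pair⊆ x∈ y∈)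

  module _ (df : DiamondFree G) where

    -- A vertex `y` of `K` not adjacent to `w` would form an induced diamond with `w` over the edge
    -- `uv`. This is why an edge determines its maximal clique.
    common-neighbour∈ : ∀ {K u v w} → IsMaxClique G K → u ∈ K → v ∈ K → u ≢ v →
      Edge G w u → Edge G w v → w ∈ K
    common-neighbour∈ {K} {u} {v} {w} mK@(clq , _) u∈ v∈ u≢v wu wv = maxClique-absorbs mK joined
      where
      joined : ∀ y → y ∈ K → y ≢ w → Edge G y w
      joined y y∈ y≢w with y Fin.≟ u | y Fin.≟ v
      ... | yes refl | _        = Edge-sym G wu
      ... | no _     | yes refl = Edge-sym G wv
      ... | no y≢u   | no y≢v   = decidable-stable (Edge? G y w) λ y≁w →
        df y w u v (y≢w , y≁w , clq u v u∈ v∈ u≢v , clq y u y∈ u∈ y≢u , clq y v y∈ v∈ y≢v , wu , wv)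

    maxClique-⊆ : ∀ {K K′ u v} → IsMaxClique G K → IsMaxClique G K′ → u ≢ v →
      u ∈ K → v ∈ K → u ∈ K′ → v ∈ K′ → K′ ⊆ K
    maxClique-⊆ {u = u} {v} mK (clq , _) u≢v u∈ v∈ u∈′ v∈′ {w} w∈′ with w Fin.≟ u | w Fin.≟ v
    ... | yes refl | _        = u∈
    ... | no _     | yes refl = v∈
    ... | no w≢u   | no w≢v   =
      common-neighbour∈ mK u∈ v∈ u≢v (clq w u w∈′ u∈′ w≢u) (clq w v w∈′ v∈′ w≢v)

    maxCliques-meet-once : ∀ {K K′ u v} → IsMaxClique G K → IsMaxClique G K′ → K ≢ K′ →
      u ∈ K → v ∈ K → u ∈ K′ → v ∈ K′ → u ≡ v
    maxCliques-meet-once {u = u} {v} mK mK′ K≢K′ u∈ v∈ u∈′ v∈′ = decidable-stable (u Fin.≟ v) λ u≢v →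
      K≢K′ (⊆-antisym (maxClique-⊆ mK′ mK u≢v u∈′ v∈′ u∈ v∈) (maxClique-⊆ mK mK′ u≢v u∈ v∈ u∈′ v∈′))

-- Odd rims are not clique-perfect

parity-suc : ∀ i → parity (suc i) ≡ parity i ⁻¹
parity-suc i = trans (ℙ.+-homo-+ 1 i) refl

p+p≡0 : ∀ p → p ℙ.+ p ≡ 0ℙ
p+p≡0 0ℙ = refl
p+p≡0 1ℙ = refl

parity-double : ∀ i → parity (i + i) ≡ 0ℙ
parity-double i = trans (ℙ.+-homo-+ i i) (p+p≡0 (parity i))

parity≡0⇒Even : ∀ i → parity i ≡ 0ℙ → Even i
parity≡1⇒Odd  : ∀ i → parity i ≡ 1ℙ → Odd i
parity≡0⇒Even zero    _  = 0 , refl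
parity≡0⇒Even (suc i) eq with parity≡1⇒Odd i (⁻¹-flip (trans (≡-sym (parity-suc i)) eq))
  where
  ⁻¹-flip : ∀ {p} → p ⁻¹ ≡ 0ℙ → p ≡ 1ℙ
  ⁻¹-flip {1ℙ} _ = refl
... | k , refl = suc k , cong suc (≡-sym (ℕ.+-suc k (k + 0)))
parity≡1⇒Odd (suc i) eq with parity≡0⇒Even i (⁻¹-flip (trans (≡-sym (parity-suc i)) eq))
  where
  ⁻¹-flip : ∀ {p} → p ⁻¹ ≡ 1ℙ → p ≡ 0ℙ
  ⁻¹-flip {0ℙ} _ = refl
... | k , refl = k , refl

Odd⇒parity≡1 : ∀ {i} → Odd i → parity i ≡ 1ℙ
Odd⇒parity≡1 (k , refl) =
  trans (parity-suc (2 * k)) (cong _⁻¹ (trans (cong (λ z → parity (k + z)) (ℕ.+-identityʳ k)) (parity-double k)))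

-- Positions on a cycle

module _ {m : ℕ} .{{_ : NonZero m}} where

  -- Positions are kept unreduced, so that arcs across the label 0 are ordinary intervals and a full
  -- turn leads from `p` to `p + m`.
  rim : ℕ → Fin m
  rim i = i mod m

  toℕ-rim : ∀ i → toℕ (rim i) ≡ i % m
  toℕ-rim i = toℕ-fromℕ< (m%n<n i m)

  rim-toℕ : ∀ x → rim (toℕ x) ≡ x
  rim-toℕ x = toℕ-injective (trans (toℕ-rim (toℕ x)) (m<n⇒m%n≡m (toℕ<n x)))

  rim-period : ∀ i → rim (i + m) ≡ rim i
  rim-period i = toℕ-injective (trans (toℕ-rim (i + m)) (trans ([m+n]%n≡m%n i m) (≡-sym (toℕ-rim i))))

  suc-% : ∀ i → suc i % m ≡ suc (i % m) % m
  suc-% i = trans (cong (λ z → suc z % m) (m≡m%n+[m/n]*n i m)) ([m+kn]%n≡m%n (suc (i % m)) (i / m) m)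

  rim-step : ∀ i → RimSucc m (rim i) (rim (suc i))
  rim-step i with ℕ.<-cmp (suc (i % m)) m
  ... | tri< lt _ _ = inj₁ (trans (toℕ-rim (suc i)) (trans (suc-% i)
          (trans (m<n⇒m%n≡m lt) (cong suc (≡-sym (toℕ-rim i))))))
  ... | tri≈ _ eq _ = inj₂ (trans (cong suc (toℕ-rim i)) eq ,
          trans (toℕ-rim (suc i)) (trans (suc-% i) (trans (cong (_% m) eq) (n%n≡0 m))))
  ... | tri> _ _ gt = contradiction (m%n<n i m) (ℕ.<⇒≱ gt)

  -- Equal remainders and `i < j` force a larger quotient for `j`, hence a distance of at least `m`.
  rim-injective : ∀ {i j} → i < j → j < i + m → rim i ≢ rim j
  rim-injective {i} {j} i<j j<i+m eq = ℕ.<⇒≱ j<i+m i+m≤j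
    where
    eq% : i % m ≡ j % m
    eq% = trans (≡-sym (toℕ-rim i)) (trans (cong toℕ eq) (toℕ-rim j))
    i/m<j/m : i / m < j / m
    i/m<j/m = ℕ.≰⇒> λ le → ℕ.<⇒≱ i<j (begin
      j                   ≡⟨ m≡m%n+[m/n]*n j m ⟩
      j % m + j / m * m   ≡⟨ cong (_+ j / m * m) (≡-sym eq%) ⟩
      i % m + j / m * m   ≤⟨ ℕ.+-monoʳ-≤ (i % m) (ℕ.*-monoˡ-≤ m le) ⟩
      i % m + i / m * m   ≡⟨ ≡-sym (m≡m%n+[m/n]*n i m) ⟩
      i                   ∎)
      where open ℕ.≤-Reasoning
    i+m≤j : i + m ≤ j
    i+m≤j = begin
      i + m                     ≡⟨ cong (_+ m) (m≡m%n+[m/n]*n i m) ⟩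
      i % m + i / m * m + m     ≡⟨ ℕ.+-assoc (i % m) (i / m * m) m ⟩
      i % m + (i / m * m + m)   ≡⟨ cong (i % m +_) (ℕ.+-comm (i / m * m) m) ⟩
      i % m + suc (i / m) * m   ≤⟨ ℕ.+-monoʳ-≤ (i % m) (ℕ.*-monoˡ-≤ m i/m<j/m) ⟩
      i % m + j / m * m         ≡⟨ cong (_+ j / m * m) eq% ⟩
      j % m + j / m * m         ≡⟨ ≡-sym (m≡m%n+[m/n]*n j m) ⟩
      j                         ∎
      where open ℕ.≤-Reasoning

  -- The window of `m` positions slides one step at a time; the position `p` that it loses returns
  -- as `p + m`.
  rim-surjective : ∀ p x → ∃[ i ] (p ≤ i × i < p + m × rim i ≡ x)
  rim-surjective zero    x = toℕ x , z≤n , toℕ<n x , rim-toℕ x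
  rim-surjective (suc p) x with rim-surjective p x
  ... | i , p≤i , i<p+m , eq with ℕ.m≤n⇒m<n∨m≡n p≤i
  ...   | inj₁ p<i  = i , p<i , ℕ.m≤n⇒m≤1+n i<p+m , eq
  ...   | inj₂ refl = p + m , ℕ.m<m+n p (>-nonZero⁻¹ m) , ℕ.≤-refl , trans (rim-period p) eq

  next : Fin m → Fin m
  next x = rim (suc (toℕ x))

  next-succ : ∀ x → RimSucc m x (next x)
  next-succ x = subst (λ z → RimSucc m z (next x)) (rim-toℕ x) (rim-step (toℕ x))

RimSucc-functional : ∀ {x y z : Fin m} → RimSucc m x y → RimSucc m x z → y ≡ z
RimSucc-functional (inj₁ p) (inj₁ q) = toℕ-injective (trans p (≡-sym q))
RimSucc-functional {y = y} (inj₁ p) (inj₂ (q , _)) = contradiction (trans p q) (ℕ.<⇒≢ (toℕ<n y))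
RimSucc-functional {z = z} (inj₂ (q , _)) (inj₁ p) = contradiction (trans p q) (ℕ.<⇒≢ (toℕ<n z))
RimSucc-functional (inj₂ (_ , p)) (inj₂ (_ , q)) = toℕ-injective (trans p (≡-sym q))

RimSucc-injective : ∀ {x y z : Fin m} → RimSucc m x z → RimSucc m y z → x ≡ y
RimSucc-injective (inj₁ p) (inj₁ q) = toℕ-injective (ℕ.suc-injective (trans (≡-sym p) q))
RimSucc-injective (inj₁ p) (inj₂ (_ , q)) = contradiction (trans (≡-sym q) p) λ ()
RimSucc-injective (inj₂ (_ , q)) (inj₁ p) = contradiction (trans (≡-sym q) p) λ ()
RimSucc-injective (inj₂ (p , _)) (inj₂ (q , _)) = toℕ-injective (ℕ.suc-injective (trans p (≡-sym q)))

-- Two members taken from each of the disjoint sets are distinct vertices throughout.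
independent-size : ∀ {Ks : List (Subset n)} → AllPairs Disjoint Ks →
  All (λ K → ∃₂ λ x y → x ∈ K × y ∈ K × x ≢ y) Ks → length Ks + length Ks ≤ n
independent-size {n} {Ks} dis two =
  let xs , u , _ , eq = representatives dis two in subst (_≤ n) eq (unique⇒length≤ u)
  where
  representatives : ∀ {Ks : List (Subset n)} → AllPairs Disjoint Ks →
    All (λ K → ∃₂ λ x y → x ∈ K × y ∈ K × x ≢ y) Ks →
    ∃[ xs ] (Unique xs × All (λ x → Any (x ∈_) Ks) xs × length xs ≡ length Ks + length Ks)
  representatives [] [] = [] , [] , [] , refl
  representatives {K ∷ Ks} (K# ∷ dis) ((x , y , x∈ , y∈ , x≢y) ∷ two) with representatives dis two
  ... | xs , u , xs∈ , eq =
    x ∷ y ∷ xs , (x≢y ∷ fresh x∈) ∷ fresh y∈ ∷ u , here x∈ ∷ here y∈ ∷ All.map there xs∈ ,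
    cong suc (trans (cong suc eq) (≡-sym (ℕ.+-suc _ _)))
    where
    fresh : ∀ {z} → z ∈ K → All (z ≢_) xs
    fresh z∈ = All.map (λ {w} w∈ z≡w →
      All.lookupWith (λ K#K′ w∈K′ → K#K′ w (subst (_∈ K) z≡w z∈) w∈K′) K# w∈) xs∈

-- `next` maps the vertices outside `T` injectively into `T`.
rim-cover-size : ∀ (T : Subset m) → .{{NonZero m}} →
  (∀ x y → RimSucc m x y → x ∈ T ⊎ y ∈ T) → m ≤ ∣ T ∣ + ∣ T ∣
rim-cover-size {m} T cover = begin
  m                                      ≡⟨ ≡-sym (List.length-tabulate id) ⟩
  length (allFin m)                      ≡⟨ length-filter-¬ (_∈? T) (allFin m) ⟩
  length ins + length outs               ≡⟨ cong (length ins +_) (≡-sym (List.length-map next outs)) ⟩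
  length ins + length (map next outs)    ≤⟨ ℕ.+-mono-≤ ins≤ outs≤ ⟩
  ∣ T ∣ + ∣ T ∣                          ∎
  where
  open ℕ.≤-Reasoning
  ins outs : List (Fin m)
  ins  = filter (_∈? T) (allFin m)
  outs = filter (¬? ∘ (_∈? T)) (allFin m)
  ins≤ : length ins ≤ ∣ T ∣
  ins≤ = unique⇒length≤∣∣ T (Unique.filter⁺ (_∈? T) (Unique.allFin⁺ m)) (All.all-filter (_∈? T) (allFin m))
  next∈ : ∀ {x} → x ∉ T → next x ∈ T
  next∈ {x} x∉ with cover x (next x) (next-succ x)
  ... | inj₁ x∈ = contradiction x∈ x∉
  ... | inj₂ y∈ = y∈
  next-injective : ∀ {x y} → next x ≡ next y → x ≡ y
  next-injective {x} {y} eq = RimSucc-injective (next-succ x) (subst (RimSucc m y) (≡-sym eq) (next-succ y))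
  outs≤ : length (map next outs) ≤ ∣ T ∣
  outs≤ = unique⇒length≤∣∣ T
    (Unique.map⁺ next-injective (Unique.filter⁺ (¬? ∘ (_∈? T)) (Unique.allFin⁺ m)))
    (All.map⁺ (All.map next∈ (All.all-filter (¬? ∘ (_∈? T)) (allFin m))))

RimSucc⇒≢ : 2 ≤ m → ∀ {x y : Fin m} → RimSucc m x y → x ≢ y
RimSucc⇒≢ _ (inj₁ p) refl = contradiction (≡-sym p) ℕ.1+n≢n
RimSucc⇒≢ 2≤m (inj₂ (p , q)) refl = ℕ.<⇒≢ 2≤m (trans (cong suc (≡-sym q)) p)

-- A transversal covers all rim edges, so `m ≤ k + k`; maximal cliques have at least two vertices,
-- so disjoint ones give `k + k ≤ m`. Then `m` would be even.
odd-rim⇒τ≢α : (G : Graph m) → Odd m → 2 ≤ m →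
  (∀ x y → RimSucc m x y → IsMaxClique G (⁅ x ⁆ ∪ ⁅ y ⁆)) → ¬ (∃[ k ] (τc≡ G k × αc≡ G k))
odd-rim⇒τ≢α {m@(suc _)} G odd 2≤m rim-max (k , ((T , trv , ∣T∣≡k) , _) , ((Ks , (mKs , dis) , ∣Ks∣≡k) , _)) =
  contradiction (trans (≡-sym (Odd⇒parity≡1 odd)) (trans (cong parity m≡k+k) (parity-double k))) λ ()
  where
  edge : ∀ x → Edge G (next x) x
  edge x = Edge-sym G (maxClique-of-edge G (rim-max x (next x) (next-succ x)) (RimSucc⇒≢ 2≤m (next-succ x)))
  two : ∀ {K} → IsMaxClique G K → ∃₂ λ x y → x ∈ K × y ∈ K × x ≢ y
  two mK@(_ , (x , x∈) , _) with maxClique-second G mK x∈ (edge x)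
  ... | y , y∈ , y≢x = x , y , x∈ , y∈ , y≢x ∘ ≡-sym
  cover : ∀ x y → RimSucc m x y → x ∈ T ⊎ y ∈ T
  cover x y s with trv _ (rim-max x y s)
  ... | z , z∈T , z∈xy with pair-members z∈xy
  ...   | inj₁ refl = inj₁ z∈T
  ...   | inj₂ refl = inj₂ z∈T
  m≡k+k : m ≡ k + k
  m≡k+k = ℕ.≤-antisym
    (subst (λ z → m ≤ z + z) ∣T∣≡k (rim-cover-size T cover))
    (subst (λ z → z + z ≤ m) ∣Ks∣≡k (independent-size dis (All.map two mKs)))

IsMaxClique-cong : (G H : Graph n) → (∀ i j → adj G i j ≡ adj H i j) → ∀ {S} → IsMaxClique G S → IsMaxClique H S
IsMaxClique-cong G H eq (clq , ne , max) =
  (λ x y x∈ y∈ x≢y → trans (≡-sym (eq x y)) (clq x y x∈ y∈ x≢y)) , ne ,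
  λ T clqT → max T λ x y x∈ y∈ x≢y → trans (eq x y) (clqT x y x∈ y∈ x≢y)

cliquePerfect⇒¬sunoid : (G : Graph n) → CliquePerfect G → ¬ HasInducedSunoid G
cliquePerfect⇒¬sunoid G cp (m , H , ((_ , odd , 3≤m , rims , _) , _) , f , inj , eq) =
  odd-rim⇒τ≢α (induced G f) odd 2≤m
    (λ x y s → IsMaxClique-cong H (induced G f) eq (proj₂ (rims x y (RimSucc⇒≢ 2≤m s)) (inj₁ s)))
    (cp m f inj)
  where 2≤m = ℕ.≤-trans (ℕ.n≤1+n 2) 3≤m

-- Three steps forward return to the start only if `m` divides 3. The cases record where the walk
-- wraps around.
RimSucc-no-triangle : 4 ≤ m → ∀ {x y z : Fin m} → RimSucc m x y → RimSucc m y z → RimSucc m z x → ⊥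
RimSucc-no-triangle _ {x} (inj₁ p) (inj₁ q) (inj₁ r) =
  ℕ.<⇒≢ (ℕ.m≤n⇒m≤1+n (ℕ.n≤1+n _)) (trans r (cong suc (trans q (cong suc p))))
RimSucc-no-triangle 4≤m (inj₁ p) (inj₁ q) (inj₂ (r , s)) =
  ℕ.<⇒≢ 4≤m (trans (≡-sym (cong suc (trans q (cong suc (trans p (cong suc s)))))) r)
RimSucc-no-triangle 4≤m (inj₁ p) (inj₂ (q , s)) (inj₁ r) =
  ℕ.<⇒≢ 4≤m (trans (≡-sym (cong suc (trans p (cong suc (trans r (cong suc s)))))) q)
RimSucc-no-triangle 4≤m (inj₂ (p , s)) (inj₁ q) (inj₁ r) =
  ℕ.<⇒≢ 4≤m (trans (≡-sym (cong suc (trans r (cong suc (trans q (cong suc s)))))) p)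
RimSucc-no-triangle 4≤m (inj₁ p) (inj₂ (q , s)) (inj₂ (r , t)) =
  contradiction (trans (≡-sym (cong suc s)) r) (ℕ.<⇒≢ (ℕ.≤-trans (s≤s (s≤s z≤n)) 4≤m))
RimSucc-no-triangle 4≤m (inj₂ (q , s)) (inj₁ p) (inj₂ (r , t)) =
  contradiction (trans (≡-sym (cong suc t)) q) (ℕ.<⇒≢ (ℕ.≤-trans (s≤s (s≤s z≤n)) 4≤m))
RimSucc-no-triangle 4≤m (inj₂ (q , s)) (inj₂ (r , t)) _ =
  contradiction (trans (≡-sym (cong suc s)) r) (ℕ.<⇒≢ (ℕ.≤-trans (s≤s (s≤s z≤n)) 4≤m))

cliquePerfect⇒¬oddHole : (G : Graph n) → CliquePerfect G → ¬ HasInducedOddHole G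
cliquePerfect⇒¬oddHole G cp (k , odd , 4≤k , f , inj , hole) =
  odd-rim⇒τ≢α (induced G f) odd (ℕ.≤-trans (s≤s (s≤s z≤n)) 4≤k)
    (λ x y s → pair-maxClique (induced G f) (proj₂ (hole x y) (inj₁ s)) (no-triangle s)) (cp k f inj)
  where
  no-triangle : ∀ {x y} → RimSucc k x y → ∀ w → Edge G (f w) (f x) → Edge G (f w) (f y) → ⊥
  no-triangle {x} {y} s w wx wy with proj₁ (hole w x) wx | proj₁ (hole w y) wy
  ... | inj₂ t | _      = Edge⇒≢ G wy (cong f (RimSucc-functional t s))
  ... | inj₁ t | inj₁ u = Edge⇒≢ G wx (cong f (RimSucc-injective u s))
  ... | inj₁ t | inj₂ u = RimSucc-no-triangle 4≤k t s u

-- Balancedness of the clique hypergraph and its bicolourings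

-- The list contains both ends, so a cycle is a path together with a step from its last vertex back
-- to its first.
data Path {A : Set} (R : A → A → Set) : A → List A → A → Set where
  ⟨_⟩ : ∀ x → Path R x (x ∷ []) x
  _∷_ : ∀ {x y xs z} → R x y → Path R y xs z → Path R x (x ∷ xs) z

module _ {A : Set} {R : A → A → Set} where

  path-++ : ∀ {x xs y u ys v} → Path R x xs y → R y u → Path R u ys v → Path R x (xs ++ ys) v
  path-++ ⟨ _ ⟩   r q = r ∷ q
  path-++ (s ∷ p) r q = s ∷ path-++ p r q

  path-head∈ : ∀ {x xs y} → Path R x xs y → x ∈ˡ xs
  path-head∈ ⟨ _ ⟩   = here refl
  path-head∈ (_ ∷ _) = here refl

  path-last∈ : ∀ {x xs y} → Path R x xs y → y ∈ˡ xs
  path-last∈ ⟨ _ ⟩   = here refl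
  path-last∈ (_ ∷ p) = there (path-last∈ p)

  path-reverse : (∀ {x y} → R x y → R y x) → ∀ {x xs y} → Path R x xs y → Path R y (reverse xs) x
  path-reverse R-sym ⟨ x ⟩ = ⟨ x ⟩
  path-reverse R-sym (_∷_ {x} {y} {xs} r p) =
    subst (λ l → Path R _ l x) (≡-sym (List.unfold-reverse x xs)) (path-++ (path-reverse R-sym p) (R-sym r) ⟨ x ⟩)

  path-map : ∀ {B : Set} {S : B → B → Set} (f : A → B) → (∀ {x y} → R x y → S (f x) (f y)) →
    ∀ {x xs y} → Path R x xs y → Path S (f x) (map f xs) (f y)
  path-map f g ⟨ x ⟩   = ⟨ f x ⟩
  path-map f g (r ∷ p) = g r ∷ path-map f g p

  path-weaken : ∀ {S : A → A → Set} → (∀ {x y} → R x y → S x y) → ∀ {x xs y} → Path R x xs y → Path S x xs y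
  path-weaken g ⟨ x ⟩   = ⟨ x ⟩
  path-weaken g (r ∷ p) = g r ∷ path-weaken g p

  path-applyUpTo : (f : ℕ → A) → ∀ k → (∀ {i} → i < k → R (f i) (f (suc i))) →
    Path R (f 0) (applyUpTo f (suc k)) (f k)
  path-applyUpTo f zero    r = ⟨ f 0 ⟩
  path-applyUpTo f (suc k) r = r (s≤s z≤n) ∷ path-applyUpTo (f ∘ suc) k (r ∘ s≤s)

  path-step : ∀ {x xs y} → Path R x xs y → ∀ i j → toℕ j ≡ suc (toℕ i) → R (lookup xs i) (lookup xs j)
  path-step (r ∷ ⟨ _ ⟩)   zero    (suc zero)    _  = r
  path-step (r ∷ (_ ∷ _)) zero    (suc zero)    _  = r
  path-step (_ ∷ p)       (suc i) (suc j)       eq = path-step p i j (ℕ.suc-injective eq)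
  path-step ⟨ _ ⟩         zero    (suc ())

  path-first : ∀ {x xs y} → Path R x xs y → ∀ i → toℕ i ≡ 0 → lookup xs i ≡ x
  path-first ⟨ _ ⟩   zero _ = refl
  path-first (_ ∷ _) zero _ = refl

  path-last : ∀ {x xs y} → Path R x xs y → ∀ i → suc (toℕ i) ≡ length xs → lookup xs i ≡ y
  path-last ⟨ _ ⟩       zero    _  = refl
  path-last (_ ∷ ⟨ _ ⟩)   zero    ()
  path-last (_ ∷ (_ ∷ _)) zero    ()
  path-last (_ ∷ p)     (suc i) eq = path-last p i (ℕ.suc-injective eq)

-- `L` stands for the vertices of the whole cycle. A common neighbour of `u` and `v` differs from
-- both by irreflexivity, so no inequalities are asked of `w`.
Proper : Graph n → List (Fin n) → Fin n → Fin n → Set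
Proper G L u v = Edge G u v × (∀ {w} → w ∈ˡ L → Edge G w u → Edge G w v → ⊥)

ProperOddCycle : Graph n → List (Fin n) → Set
ProperOddCycle G L =
  ∃₂ λ u v → Path (Proper G L) u L v × Proper G L v u × Unique L × parity (length L) ≡ 1ℙ

properOddCycle-map : (G : Graph n) {f : Fin m → Fin n} → Injective _≡_ _≡_ f →
  ∀ {L} → ProperOddCycle (induced G f) L → ProperOddCycle G (map f L)
properOddCycle-map G {f} f-inj {L} (u , v , p , q , uniq , odd) =
  f u , f v , path-map f proper p , proper q , Unique.map⁺ f-inj uniq ,
  trans (cong parity (List.length-map f L)) odd
  where
  proper : ∀ {x y} → Proper (induced G f) L x y → Proper G (map f L) (f x) (f y)
  proper {x} {y} (e , none) = e , third
    where
    third : ∀ {w} → w ∈ˡ map f L → Edge G w (f x) → Edge G w (f y) → ⊥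
    third w∈ wx wy with ∈ˡ.∈-map⁻ f w∈
    ... | w′ , w′∈ , refl = none w′∈ wx wy

flip : Parity → Bool → Bool
flip 0ℙ b = b
flip 1ℙ b = not b

flip-⁻¹ : ∀ p b → flip (p ⁻¹) b ≡ not (flip p b)
flip-⁻¹ 0ℙ b     = refl
flip-⁻¹ 1ℙ true  = refl
flip-⁻¹ 1ℙ false = refl

≢⇒≡not : ∀ {a b} → b ≢ a → b ≡ not a
≢⇒≡not {false} {false} b≢a = contradiction refl b≢a
≢⇒≡not {false} {true}  _   = refl
≢⇒≡not {true}  {false} _   = refl
≢⇒≡not {true}  {true}  b≢a = contradiction refl b≢a

not≢ : ∀ {a b} → a ≡ b → not a ≢ b
not≢ {true}  refl ()
not≢ {false} refl ()

-- The members of the family are coloured, not the vertices: a vertex in at least two members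
-- indexed by `S` must meet both colours.
Bicolours : ∀ {N} → (Fin N → Subset n) → Subset N → (Fin N → Bool) → Set
Bicolours Q S β = ∀ x i j → i ∈ S → j ∈ S → i ≢ j → x ∈ Q i → x ∈ Q j →
  ∃₂ λ i′ j′ → i′ ∈ S × j′ ∈ S × x ∈ Q i′ × x ∈ Q j′ × β i′ ≢ β j′

module CliqueFamily (G : Graph n) (df : DiamondFree G) (balanced : ∀ L → ¬ ProperOddCycle G L)
  {N : ℕ} (Q : Fin N → Subset n) (Q-max : ∀ i → IsMaxClique G (Q i)) where

  -- The common vertex has degree two within `S`; at such vertices a bicolouring forces two
  -- particular members to differ.
  record Link (S : Subset N) (i j : Fin N) : Set where
    constructor link
    field
      i∈S    : i ∈ S
      j∈S    : j ∈ S
      i≢j    : i ≢ j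
      common : ∃[ x ] (x ∈ Q i × x ∈ Q j × (∀ l → l ∈ S → x ∈ Q l → l ≡ i ⊎ l ≡ j))
  open Link

  Link? : ∀ S i j → Dec (Link S i j)
  Link? S i j = map′ (λ (a , b , c , d) → link a b c d) (λ l → i∈S l , j∈S l , i≢j l , common l)
    ((i ∈? S) ×-dec (j ∈? S) ×-dec ¬? (i Fin.≟ j) ×-dec
     any? (λ x → (x ∈? Q i) ×-dec (x ∈? Q j) ×-dec
       all? (λ l → (l ∈? S) →-dec (x ∈? Q l) →-dec ((l Fin.≟ i) ⊎-dec (l Fin.≟ j)))))

  -- The common vertices of consecutive cliques of an odd cycle of links form a proper odd cycle of G.
  no-odd-link-cycle : ∀ {S} (f : ℕ → Fin N) k → parity k ≡ 0ℙ →
    (∀ {i j} → i < j → j ≤ k → f i ≢ f j) → (∀ {i} → i < k → Link S (f i) (f (suc i))) →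
    ¬ Link S (f k) (f 0)
  no-odd-link-cycle {S} f k even f-inj links close = balanced (applyUpTo x (suc k))
    (x 0 , x k , path-applyUpTo x k consecutive , closing ,
     Unique.applyUpTo⁺₁ x (suc k) (λ i<j j<1+k → x-inj i<j (ℕ.≤-pred j<1+k)) ,
     trans (cong parity (List.length-applyUpTo x (suc k))) (trans (parity-suc k) (cong _⁻¹ even)))
    where
    x : ℕ → Fin n
    x i with i <? k
    ... | yes i<k = proj₁ (common (links i<k))
    ... | no  _   = proj₁ (common close)

    x∈ : ∀ i → i ≤ k → x i ∈ Q (f i)
    x∈ i i≤k with i <? k
    ... | yes i<k = proj₁ (proj₂ (common (links i<k)))
    ... | no  i≮k with refl ← ℕ.≤∧≮⇒≡ i≤k i≮k = proj₁ (proj₂ (common close))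

    x∈suc : ∀ i → i < k → x i ∈ Q (f (suc i))
    x∈suc i i<k with i <? k
    ... | yes i<k′ = proj₁ (proj₂ (proj₂ (common (links i<k′))))
    ... | no  i≮k  = contradiction i<k i≮k

    x∈0 : x k ∈ Q (f 0)
    x∈0 with k <? k
    ... | yes k<k = contradiction k<k (ℕ.<-irrefl refl)
    ... | no  _   = proj₁ (proj₂ (proj₂ (common close)))

    f∈S : ∀ j → j ≤ k → f j ∈ S
    f∈S j j≤k with ℕ.m≤n⇒m<n∨m≡n j≤k
    ... | inj₁ j<k  = i∈S (links j<k)
    ... | inj₂ refl = i∈S close

    f-inj′ : ∀ {i j} → i ≤ k → j ≤ k → f i ≡ f j → i ≡ j
    f-inj′ {i} {j} i≤k j≤k eq with ℕ.<-cmp i j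
    ... | tri< i<j _ _ = contradiction eq (f-inj i<j j≤k)
    ... | tri≈ _ i≡j _ = i≡j
    ... | tri> _ _ j<i = contradiction (≡-sym eq) (f-inj j<i i≤k)

    only : ∀ i j → i ≤ k → j ≤ k → x i ∈ Q (f j) → j ≡ i ⊎ (j ≡ suc i × i < k) ⊎ (i ≡ k × j ≡ 0)
    only i j i≤k j≤k x∈Qj with i <? k
    ... | yes i<k with proj₂ (proj₂ (proj₂ (common (links i<k)))) (f j) (f∈S j j≤k) x∈Qj
    ...   | inj₁ eq = inj₁ (f-inj′ j≤k i≤k eq)
    ...   | inj₂ eq = inj₂ (inj₁ (f-inj′ j≤k i<k eq , i<k))
    only i j i≤k j≤k x∈Qj | no i≮k with refl ← ℕ.≤∧≮⇒≡ i≤k i≮k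
      with proj₂ (proj₂ (proj₂ (common close))) (f j) (f∈S j j≤k) x∈Qj
    ... | inj₁ eq = inj₁ (f-inj′ j≤k i≤k eq)
    ... | inj₂ eq = inj₂ (inj₂ (refl , f-inj′ j≤k z≤n eq))

    x-inj : ∀ {i j} → i < j → j ≤ k → x i ≢ x j
    x-inj {i} {j} i<j j≤k eq
      with only i j (ℕ.<⇒≤ (ℕ.<-≤-trans i<j j≤k)) j≤k (subst (_∈ Q (f j)) (≡-sym eq) (x∈ j j≤k))
    ... | inj₁ refl = ℕ.<-irrefl refl i<j
    ... | inj₂ (inj₂ (_ , refl)) = contradiction i<j λ ()
    ... | inj₂ (inj₁ (refl , i<k))
      with only (suc i) i j≤k (ℕ.<⇒≤ i<k) (subst (_∈ Q (f i)) eq (x∈ i (ℕ.<⇒≤ i<k)))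
    ...   | inj₁ eq′ = ℕ.1+n≢n (≡-sym eq′)
    ...   | inj₂ (inj₁ (eq′ , _)) = contradiction eq′ (ℕ.<⇒≢ (ℕ.m≤n⇒m≤1+n ℕ.≤-refl))
    -- Here `k` would be 1, a cycle of two links, which the parity of `k` excludes.
    ...   | inj₂ (inj₂ (refl , refl)) = contradiction even λ ()

    k≢0 : k ≢ 0
    k≢0 refl = i≢j close refl

    consecutive : ∀ {i} → i < k → Proper G (applyUpTo x (suc k)) (x i) (x (suc i))
    consecutive {i} i<k =
      proj₁ (Q-max (f (suc i))) (x i) (x (suc i)) xi∈ xsi∈ xi≢ , third
      where
      xi∈  = x∈suc i i<k
      xsi∈ = x∈ (suc i) i<k
      xi≢  = x-inj (ℕ.≤-refl {suc i}) i<k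
      third : ∀ {w} → w ∈ˡ applyUpTo x (suc k) → Edge G w (x i) → Edge G w (x (suc i)) → ⊥
      third w∈ wx wy with ∈ˡ.∈-applyUpTo⁻ x w∈
      -- A common neighbour belongs to the clique `Q (f (suc i))`, and the only cycle vertices there
      -- are `x i` and `x (suc i)`.
      ... | t , s≤s t≤k , refl
        with only t (suc i) t≤k i<k (common-neighbour∈ G df (Q-max (f (suc i))) xi∈ xsi∈ xi≢ wx wy)
      ...   | inj₁ refl = Edge⇒≢ G wy refl
      ...   | inj₂ (inj₁ (refl , _)) = Edge⇒≢ G wx refl
      ...   | inj₂ (inj₂ (_ , ()))

    closing : Proper G (applyUpTo x (suc k)) (x k) (x 0)
    closing = proj₁ (Q-max (f 0)) (x k) (x 0) x∈0 (x∈ 0 z≤n) xk≢x0 , third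
      where
      xk≢x0 : x k ≢ x 0
      xk≢x0 eq = x-inj (ℕ.n≢0⇒n>0 k≢0) ℕ.≤-refl (≡-sym eq)
      third : ∀ {w} → w ∈ˡ applyUpTo x (suc k) → Edge G w (x k) → Edge G w (x 0) → ⊥
      third w∈ wx wy with ∈ˡ.∈-applyUpTo⁻ x w∈
      ... | t , s≤s t≤k , refl
        with only t 0 t≤k z≤n (common-neighbour∈ G df (Q-max (f 0)) x∈0 (x∈ 0 z≤n) xk≢x0 wx wy)
      ...   | inj₁ refl = Edge⇒≢ G wy refl
      ...   | inj₂ (inj₂ (refl , _)) = Edge⇒≢ G wx refl

  record LinkPath (S : Subset N) : Set where
    field
      len     : ℕ
      at      : ℕ → Fin N
      at∈     : at 0 ∈ S
      at-inj  : ∀ {i j} → i < j → j ≤ len → at i ≢ at j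
      at-link : ∀ {i} → i < len → Link S (at i) (at (suc i))

    Inextensible : Set
    Inextensible = ∀ j → Link S j (at 0) → ∃[ i ] (i ≤ len × at i ≡ j)

    len<N : len < N
    len<N = injective⇒≤ {f = at ∘ toℕ {suc len}} λ {i} {j} eq → toℕ-injective (inj′ i j eq)
      where
      inj′ : ∀ (i j : Fin (suc len)) → at (toℕ i) ≡ at (toℕ j) → toℕ i ≡ toℕ j
      inj′ i j eq with ℕ.<-cmp (toℕ i) (toℕ j)
      ... | tri< i<j _ _ = contradiction eq (at-inj i<j (ℕ.≤-pred (toℕ<n j)))
      ... | tri≈ _ i≡j _ = i≡j
      ... | tri> _ _ j<i = contradiction (≡-sym eq) (at-inj j<i (ℕ.≤-pred (toℕ<n i)))
  open LinkPath

  -- The path grows at its front. Its members are distinct, so its length stays below `N`, and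
  -- `fuel` bounds the extensions still possible.
  inextensible : ∀ {S} fuel (p : LinkPath S) → N ≤ fuel + len p → ∃[ q ] Inextensible {S} q
  inextensible zero p N≤ = contradiction (len<N p) (ℕ.≤⇒≯ N≤)
  inextensible {S} (suc fuel) p N≤
    with any? (λ j → Link? S j (at p 0) ×-dec ¬? (any? λ (i : Fin (suc (len p))) → at p (toℕ i) Fin.≟ j))
  ... | no ∄j = p , λ j l → covered j (decidable-stable
        (any? λ (i : Fin (suc (len p))) → at p (toℕ i) Fin.≟ j) λ ∄i → ∄j (j , l , ∄i))
    where
    covered : ∀ j → ∃[ i ] at p (toℕ {suc (len p)} i) ≡ j → ∃[ i ] (i ≤ len p × at p i ≡ j)
    covered j (i , eq) = toℕ i , ℕ.≤-pred (toℕ<n i) , eq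
  ... | yes (j , l , ∄i) = inextensible fuel longer (subst (N ≤_) (≡-sym (ℕ.+-suc fuel (len p))) N≤)
    where
    at′ : ℕ → Fin N
    at′ zero    = j
    at′ (suc i) = at p i
    at′-inj : ∀ {i i′} → i < i′ → i′ ≤ suc (len p) → at′ i ≢ at′ i′
    at′-inj {zero}  {suc i′} _ (s≤s i′≤) eq =
      ∄i (fromℕ< (s≤s i′≤) , trans (cong (at p) (toℕ-fromℕ< (s≤s i′≤))) (≡-sym eq))
    at′-inj {suc i} {suc i′} (s≤s i<i′) (s≤s i′≤) = at-inj p i<i′ i′≤
    at′-link : ∀ {i} → i < suc (len p) → Link S (at′ i) (at′ (suc i))
    at′-link {zero}  _       = l
    at′-link {suc i} (s≤s h) = at-link p h
    longer : LinkPath S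
    longer = record { len = suc (len p) ; at = at′ ; at∈ = i∈S l ; at-inj = at′-inj ; at-link = at′-link }

  -- The common vertex lies in no third member of `S`, so the two differently coloured members that
  -- it meets are `i` and `j`.
  Bicolours-link : ∀ {S β i j} → Bicolours Q S β → Link S i j → β j ≡ not (β i)
  Bicolours-link {S} {β} {i} {j} bi (link i∈ j∈ i≢j (x , x∈i , x∈j , only)) with bi x i j i∈ j∈ i≢j x∈i x∈j
  ... | i′ , j′ , i′∈ , j′∈ , x∈i′ , x∈j′ , β≢ with only i′ i′∈ x∈i′ | only j′ j′∈ x∈j′
  ...   | inj₁ refl | inj₁ refl = contradiction refl β≢
  ...   | inj₁ refl | inj₂ refl = ≢⇒≡not (β≢ ∘ ≡-sym)
  ...   | inj₂ refl | inj₁ refl = ≢⇒≡not β≢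
  ...   | inj₂ refl | inj₂ refl = contradiction refl β≢

  Link-remove : ∀ {S i j v} → Link S i j → i ≢ v → j ≢ v → Link (S - v) i j
  Link-remove {S} {v = v} (link i∈ j∈ i≢j (x , x∈i , x∈j , only)) i≢v j≢v =
    link (Subset.x∈p∧x≢y⇒x∈p-y i∈ i≢v) (Subset.x∈p∧x≢y⇒x∈p-y j∈ j≢v) i≢j
      (x , x∈i , x∈j , λ l l∈ → only l (Subset.p─q⊆p S ⁅ v ⁆ l∈))

  -- The first vertex v of an inextensible path of links has all its linked cliques on the path, where
  -- the colours alternate; parity then makes them all of one colour, and v receives the other one.
  extend-bicolouring : ∀ {S} (p : LinkPath S) → Inextensible p →
    ∃[ β ] Bicolours Q (S - at p 0) β → ∃[ β ] Bicolours Q S β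
  extend-bicolouring {S} p stuck (β , bi) = β′ , bi′
    where
    v = at p 0

    β′ : Fin N → Bool
    β′ i with i Fin.≟ v
    -- If the path has length 0, nothing is linked to `v` and `at p 1` is an arbitrary default.
    ... | yes _ = not (β (at p 1))
    ... | no  _ = β i

    β′-v : β′ v ≡ not (β (at p 1))
    β′-v with v Fin.≟ v
    ... | yes _  = refl
    ... | no v≢v = contradiction refl v≢v

    β′-other : ∀ {i} → i ≢ v → β′ i ≡ β i
    β′-other {i} i≢v with i Fin.≟ v
    ... | yes i≡v = contradiction i≡v i≢v
    ... | no _    = refl

    ∈S-v : ∀ {i} → i ∈ S → i ≢ v → i ∈ S - v
    ∈S-v = Subset.x∈p∧x≢y⇒x∈p-y

    ∈S : ∀ {i} → i ∈ S - v → i ∈ S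
    ∈S = Subset.p─q⊆p S ⁅ v ⁆

    ∈S-v⇒≢ : ∀ {i} → i ∈ S - v → i ≢ v
    ∈S-v⇒≢ i∈ refl = x∉p-x i∈

    alternate : ∀ s → suc s ≤ len p → β (at p (suc s)) ≡ flip (parity s) (β (at p 1))
    alternate zero    _  = refl
    alternate (suc s) lt = begin
      β (at p (suc (suc s)))               ≡⟨ Bicolours-link bi (Link-remove (at-link p lt)
                                               (at-inj p {0} {suc s} (s≤s z≤n) (ℕ.<⇒≤ lt) ∘ ≡-sym)
                                               (at-inj p {0} {suc (suc s)} (s≤s z≤n) lt ∘ ≡-sym)) ⟩
      not (β (at p (suc s)))               ≡⟨ cong not (alternate s (ℕ.<⇒≤ lt)) ⟩
      not (flip (parity s) (β (at p 1)))   ≡⟨ ≡-sym (flip-⁻¹ (parity s) _) ⟩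
      flip (parity s ⁻¹) (β (at p 1))      ≡⟨ cong (λ q → flip q (β (at p 1))) (≡-sym (parity-suc s)) ⟩
      flip (parity (suc s)) (β (at p 1))   ∎
      where open ≡-Reasoning

    same-colour : ∀ {j} → Link S j v → β j ≡ β (at p 1)
    same-colour {j} l with stuck j l
    ... | zero  , _   , eq = contradiction (≡-sym eq) (i≢j l)
    ... | suc s , s<  , refl with parity s in eq
    ...   | 0ℙ = trans (alternate s s<) (cong (λ q → flip q _) eq)
    -- With `s` odd, the positions 0 to `suc s` and the link back to `v` form an odd cycle.
    ...   | 1ℙ = ⊥-elim (no-odd-link-cycle (at p) (suc s) (trans (parity-suc s) (cong _⁻¹ eq))
             (λ i<j j≤ → at-inj p i<j (ℕ.≤-trans j≤ s<)) (λ i< → at-link p (ℕ.<-≤-trans i< s<)) l)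

    within : ∀ x i j → i ∈ S - v → j ∈ S - v → i ≢ j → x ∈ Q i → x ∈ Q j →
      ∃₂ λ i′ j′ → i′ ∈ S × j′ ∈ S × x ∈ Q i′ × x ∈ Q j′ × β′ i′ ≢ β′ j′
    within x i j i∈ j∈ i≢j x∈i x∈j with bi x i j i∈ j∈ i≢j x∈i x∈j
    ... | i′ , j′ , i′∈ , j′∈ , x∈i′ , x∈j′ , β≢ = i′ , j′ , ∈S i′∈ , ∈S j′∈ , x∈i′ , x∈j′ ,
      λ eq → β≢ (trans (≡-sym (β′-other (∈S-v⇒≢ i′∈))) (trans eq (β′-other (∈S-v⇒≢ j′∈))))

    at-v : ∀ x j → v ∈ S → j ∈ S → j ≢ v → x ∈ Q v → x ∈ Q j →
      ∃₂ λ i′ j′ → i′ ∈ S × j′ ∈ S × x ∈ Q i′ × x ∈ Q j′ × β′ i′ ≢ β′ j′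
    at-v x j v∈ j∈ j≢v x∈v x∈j
      with any? (λ l → (l ∈? S) ×-dec (x ∈? Q l) ×-dec ¬? (l Fin.≟ j) ×-dec ¬? (l Fin.≟ v))
    ... | yes (l , l∈ , x∈l , l≢j , l≢v) = within x l j (∈S-v l∈ l≢v) (∈S-v j∈ j≢v) l≢j x∈l x∈j
    -- Now `v` and `j` are the only members through `x`, so `x` links them and `j` has the colour
    -- opposite to the new one of `v`.
    ... | no ∄l = v , j , v∈ , j∈ , x∈v , x∈j , λ eq →
      not≢ (≡-sym (same-colour (link j∈ v∈ j≢v (x , x∈j , x∈v , only))))
        (trans (≡-sym β′-v) (trans eq (β′-other j≢v)))
      where
      only : ∀ l → l ∈ S → x ∈ Q l → l ≡ j ⊎ l ≡ v
      only l l∈ x∈l with l Fin.≟ j | l Fin.≟ v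
      ... | yes l≡j | _       = inj₁ l≡j
      ... | no _    | yes l≡v = inj₂ l≡v
      ... | no l≢j  | no l≢v  = contradiction (l , l∈ , x∈l , l≢j , l≢v) ∄l

    bi′ : Bicolours Q S β′
    bi′ x i j i∈ j∈ i≢j x∈i x∈j with i Fin.≟ v | j Fin.≟ v
    ... | yes refl | yes refl = contradiction refl i≢j
    ... | yes refl | no j≢v   = at-v x j i∈ j∈ j≢v x∈i x∈j
    ... | no i≢v   | yes refl = at-v x i j∈ i∈ i≢v x∈j x∈i
    ... | no i≢v   | no j≢v   = within x i j (∈S-v i∈ i≢v) (∈S-v j∈ j≢v) i≢j x∈i x∈j

  -- Induction on the size of `S`: the first member of an inextensible path is removed and coloured
  -- last.
  bicolouring : ∀ S → ∃[ β ] Bicolours Q S β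
  bicolouring S = go ∣ S ∣ S ℕ.≤-refl
    where
    go : ∀ size S → ∣ S ∣ ≤ size → ∃[ β ] Bicolours Q S β
    go size S le with any? (_∈? S)
    go size S le | no ∄s = (λ _ → true) , λ x i j i∈ → contradiction (i , i∈) ∄s
    go zero S le | yes (s , s∈) = contradiction (ℕ.≤-trans (ℕ.≤-<-trans z≤n (Subset.x∈p⇒∣p-x∣<∣p∣ s∈)) le) λ ()
    go (suc size) S le | yes (s , s∈) with inextensible N start′ (ℕ.m≤m+n N 0)
      where
      start′ : LinkPath S
      start′ = record { len = 0 ; at = λ _ → s ; at∈ = s∈ ; at-inj = λ { () z≤n } ; at-link = λ () }
    ... | p , stuck = extend-bicolouring p stuck
      (go size (S - at p 0) (ℕ.≤-pred (ℕ.≤-trans (Subset.x∈p⇒∣p-x∣<∣p∣ (at∈ p)) le)))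

-- Edge colouring with as many colours as the maximum degree

∑ : (Fin n → ℕ) → ℕ
∑ {zero}  f = 0
∑ {suc n} f = f zero + ∑ (f ∘ suc)

∑-mono-≤ : {f g : Fin n → ℕ} → (∀ i → f i ≤ g i) → ∑ f ≤ ∑ g
∑-mono-≤ {zero}  le = z≤n
∑-mono-≤ {suc n} le = ℕ.+-mono-≤ (le zero) (∑-mono-≤ (le ∘ suc))

∑-mono-< : {f g : Fin n → ℕ} → (∀ i → f i ≤ g i) → ∀ i → f i < g i → ∑ f < ∑ g
∑-mono-< le zero    lt = ℕ.+-mono-<-≤ lt (∑-mono-≤ (le ∘ suc))
∑-mono-< le (suc i) lt = ℕ.+-mono-≤-< (le zero) (∑-mono-< (le ∘ suc) i lt)

∑-bound : ∀ {k} {f : Fin n → ℕ} → (∀ i → f i ≤ k) → ∑ f ≤ n * k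
∑-bound {zero}  le = z≤n
∑-bound {suc n} le = ℕ.+-mono-≤ (le zero) (∑-bound (le ∘ suc))

select : {P : Fin n → Set} → Decidable P → Subset n
select P? = Vec.tabulate (λ i → does (P? i))

select⁺ : {P : Fin n → Set} (P? : Decidable P) → ∀ {i} → P i → i ∈ select P?
select⁺ P? {i} p = Vec.lookup⇒[]= i _ (trans (Vec.lookup∘tabulate _ i) (dec-true (P? i) p))

select⁻ : {P : Fin n → Set} (P? : Decidable P) → ∀ {i} → i ∈ select P? → P i
select⁻ P? {i} i∈ with P? i | trans (≡-sym (Vec.lookup∘tabulate (λ i → does (P? i)) i)) (Vec.[]=⇒lookup i∈)
... | yes p | _ = p

exchange-∣∣ : ∀ {A B : Subset n} {c d} → c ∈ B → A ⊆ (B - c) ∪ ⁅ d ⁆ → ∣ A ∣ ≤ ∣ B ∣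
exchange-∣∣ {A = A} {B} {c} {d} c∈B A⊆ = begin
  ∣ A ∣                    ≤⟨ Subset.p⊆q⇒∣p∣≤∣q∣ A⊆ ⟩
  ∣ (B - c) ∪ ⁅ d ⁆ ∣      ≤⟨ ∣p∪q∣≤∣p∣+∣q∣ (B - c) ⁅ d ⁆ ⟩
  ∣ B - c ∣ + ∣ ⁅ d ⁆ ∣    ≡⟨ cong (∣ B - c ∣ +_) (Subset.∣⁅x⁆∣≡1 d) ⟩
  ∣ B - c ∣ + 1            ≡⟨ ℕ.+-comm ∣ B - c ∣ 1 ⟩
  suc ∣ B - c ∣            ≤⟨ Subset.x∈p⇒∣p-x∣<∣p∣ c∈B ⟩
  ∣ B ∣                    ∎
  where open ℕ.≤-Reasoning

-- The degree bound is given as an injection `δ` of the members through `x` into `k` labels, which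
-- avoids counting them.
module EdgeColouring {n N k : ℕ} (Q : Fin N → Subset n) (bicolouring : ∀ S → ∃[ β ] Bicolours Q S β)
  (Q-nonempty : ∀ i → Nonempty (Q i))
  (degree≤k : ∀ x → Σ (∀ i → x ∈ Q i → Fin k) λ δ → ∀ i j p q → δ i p ≡ δ j q → i ≡ j) where

  seen? : ∀ (col : Fin N → Fin k) x a → Dec (∃[ i ] (x ∈ Q i × col i ≡ a))
  seen? col x a = any? (λ i → (x ∈? Q i) ×-dec (col i Fin.≟ a))

  seen : (Fin N → Fin k) → Fin n → Subset k
  seen col x = select (seen? col x)

  seen⁺ : ∀ col {x i} → x ∈ Q i → col i ∈ seen col x
  seen⁺ col {x} {i} x∈ = select⁺ (seen? col x) (i , x∈ , refl)

  seen⁻ : ∀ col {x a} → a ∈ seen col x → ∃[ i ] (x ∈ Q i × col i ≡ a)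
  seen⁻ col {x} = select⁻ (seen? col x)

  -- Each recolouring raises this number, which is at most `n * k`.
  potential : (Fin N → Fin k) → ℕ
  potential col = ∑ (λ x → ∣ seen col x ∣)

  Clash : (Fin N → Fin k) → Fin n → Fin N → Fin N → Set
  Clash col x i j = x ∈ Q i × x ∈ Q j × i ≢ j × col i ≡ col j

  -- If all `k` colours occurred at `x`, a chosen member of each colour and whichever of `i` and `j`
  -- was not chosen would be `k + 1` members through `x`.
  missing-colour : ∀ col {x i j} → Clash col x i j → ∃[ b ] b ∉ seen col x
  missing-colour col {x} {i} {j} (x∈i , x∈j , i≢j , same)
    with any? (λ b → ¬? (b ∈? seen col x))
  ... | yes r  = r
  ... | no ∄b = contradiction (injective⇒≤ {f = g} g-injective) ℕ.1+n≰n
    where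
    δ   = proj₁ (degree≤k x)
    δ-injective = proj₂ (degree≤k x)
    witness : ∀ b → ∃[ l ] (x ∈ Q l × col l ≡ b)
    witness b = seen⁻ col (decidable-stable (b ∈? seen col x) λ b∉ → ∄b (b , b∉))
    unhit : ∃[ l ] (x ∈ Q l × ∀ b → l ≢ proj₁ (witness b))
    unhit with proj₁ (witness (col i)) Fin.≟ i
    ... | yes eq = j , x∈j , λ b j≡ → i≢j (trans (≡-sym eq) (trans
            (cong (proj₁ ∘ witness) (trans same (trans (cong col j≡) (proj₂ (proj₂ (witness b)))))) (≡-sym j≡)))
    ... | no neq = i , x∈i , λ b i≡ → neq (trans
            (cong (proj₁ ∘ witness) (trans (cong col i≡) (proj₂ (proj₂ (witness b))))) (≡-sym i≡))
    g : Fin (suc k) → Fin k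
    g zero    = δ (proj₁ unhit) (proj₁ (proj₂ unhit))
    g (suc b) = δ (proj₁ (witness b)) (proj₁ (proj₂ (witness b)))
    g-injective : Injective _≡_ _≡_ g
    g-injective {zero}  {zero}  _  = refl
    g-injective {zero}  {suc b} eq = contradiction (δ-injective _ _ _ _ eq) (proj₂ (proj₂ unhit) b)
    g-injective {suc a} {zero}  eq = contradiction (≡-sym (δ-injective _ _ _ _ eq)) (proj₂ (proj₂ unhit) a)
    g-injective {suc a} {suc b} eq = cong suc (trans (≡-sym (proj₂ (proj₂ (witness a))))
      (trans (cong col (δ-injective _ _ _ _ eq)) (proj₂ (proj₂ (witness b)))))

  -- Recolouring the classes a and b by a bicolouring of their union loses no colour count at any vertex.
  recolour : ∀ col {x i j b} → Clash col x i j → b ∉ seen col x → ∃[ col′ ] potential col < potential col′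
  recolour col {x₀} {i₀} {j₀} {b} (x₀∈i , x₀∈j , i₀≢j₀ , same) b∉ = col′ , ∑-mono-< weak x₀ strict
    where
    a = col i₀

    ab? : Decidable (λ i → col i ≡ a ⊎ col i ≡ b)
    ab? i = (col i Fin.≟ a) ⊎-dec (col i Fin.≟ b)

    S = select ab?
    β  = proj₁ (bicolouring S)
    bi = proj₂ (bicolouring S)

    ab : Bool → Fin k
    ab true  = a
    ab false = b

    col′ : Fin N → Fin k
    col′ i with i ∈? S
    ... | yes _ = ab (β i)
    ... | no  _ = col i

    col′-in : ∀ {i} → i ∈ S → col′ i ≡ ab (β i)
    col′-in {i} i∈ with i ∈? S
    ... | yes _  = refl
    ... | no i∉  = contradiction i∈ i∉

    col′-out : ∀ {i} → i ∉ S → col′ i ≡ col i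
    col′-out {i} i∉ with i ∈? S
    ... | yes i∈ = contradiction i∈ i∉
    ... | no  _  = refl

    ab∈S : ∀ {i} c → col i ≡ ab c → i ∈ S
    ab∈S true  eq = select⁺ ab? (inj₁ eq)
    ab∈S false eq = select⁺ ab? (inj₂ eq)

    kept : ∀ {x i} → x ∈ Q i → i ∉ S → col i ∈ seen col′ x
    kept x∈ i∉ = subst (_∈ seen col′ _) (col′-out i∉) (seen⁺ col′ x∈)

    both : ∀ {x i j} → i ∈ S → j ∈ S → i ≢ j → x ∈ Q i → x ∈ Q j → ∀ c → ab c ∈ seen col′ x
    both {x} {i} {j} i∈ j∈ i≢j x∈i x∈j c with bi x i j i∈ j∈ i≢j x∈i x∈j
    ... | i′ , j′ , i′∈ , j′∈ , x∈i′ , x∈j′ , β≢ with β i′ Bool.≟ c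
    ...   | yes refl = subst (_∈ seen col′ x) (col′-in i′∈) (seen⁺ col′ x∈i′)
    ...   | no βi≢c  = subst (_∈ seen col′ x) (trans (col′-in j′∈) (cong ab βj≡c)) (seen⁺ col′ x∈j′)
      where
      βj≡c : β j′ ≡ c
      βj≡c = trans (≢⇒≡not (β≢ ∘ ≡-sym)) (≡-sym (≢⇒≡not (βi≢c ∘ ≡-sym)))

    ab-colour : ∀ {i} → i ∈ S → ∃[ c ] col i ≡ ab c
    ab-colour i∈ with select⁻ ab? i∈
    ... | inj₁ eq = true , eq
    ... | inj₂ eq = false , eq

    both-⊆ : ∀ {x i j} → i ∈ S → j ∈ S → i ≢ j → x ∈ Q i → x ∈ Q j → seen col x ⊆ seen col′ x
    both-⊆ {x} i∈ j∈ i≢j x∈i x∈j {z} z∈ with seen⁻ col z∈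
    ... | l , x∈l , refl with l ∈? S
    ...   | no l∉  = kept x∈l l∉
    ...   | yes l∈ = let c , eq = ab-colour l∈ in subst (_∈ seen col′ x) (≡-sym eq) (both i∈ j∈ i≢j x∈i x∈j c)

    weak : ∀ x → ∣ seen col x ∣ ≤ ∣ seen col′ x ∣
    weak x with any? (λ e → (e ∈? S) ×-dec (x ∈? Q e))
    ... | no ∄e = Subset.p⊆q⇒∣p∣≤∣q∣ λ z∈ → unrecoloured (seen⁻ col z∈)
      where
      unrecoloured : ∀ {z} → ∃[ l ] (x ∈ Q l × col l ≡ z) → z ∈ seen col′ x
      unrecoloured (l , x∈l , refl) = kept x∈l λ l∈ → ∄e (l , l∈ , x∈l)
    ... | yes (e , e∈ , x∈e) with any? (λ l → (l ∈? S) ×-dec (x ∈? Q l) ×-dec ¬? (e Fin.≟ l))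
    ...   | yes (l , l∈ , x∈l , e≢l) = Subset.p⊆q⇒∣p∣≤∣q∣ (both-⊆ e∈ l∈ e≢l x∈e x∈l)
    -- `e` is the only member through `x` that is recoloured, so at worst `col e` is traded for
    -- `col′ e`.
    ...   | no ∄l = exchange-∣∣ {c = col′ e} {d = col e} (seen⁺ col′ x∈e) λ z∈ → exchanged (seen⁻ col z∈)
      where
      exchanged : ∀ {z} → ∃[ l ] (x ∈ Q l × col l ≡ z) → z ∈ (seen col′ x - col′ e) ∪ ⁅ col e ⁆
      exchanged (l , x∈l , refl) with l ∈? S
      ... | yes l∈ with refl ← decidable-stable (e Fin.≟ l) (λ e≢l → ∄l (l , l∈ , x∈l , e≢l)) =
              x∈p∪q⁺ (inj₂ (x∈⁅x⁆ _))
      -- A member outside `S` has neither colour `a` nor colour `b`, hence not `col′ e`.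
      ... | no l∉  = x∈p∪q⁺ (inj₁ (Subset.x∈p∧x≢y⇒x∈p-y (kept x∈l l∉) λ eq →
              l∉ (ab∈S (β e) (trans eq (col′-in e∈)))))

    strict : ∣ seen col x₀ ∣ < ∣ seen col′ x₀ ∣
    strict = Subset.p⊂q⇒∣p∣<∣q∣ (both-⊆ i₀∈ j₀∈ i₀≢j₀ x₀∈i x₀∈j , b , both i₀∈ j₀∈ i₀≢j₀ x₀∈i x₀∈j false , b∉)
      where
      i₀∈ = select⁺ ab? (inj₁ refl)
      j₀∈ = select⁺ ab? (inj₁ (≡-sym same))

  -- While two members through a vertex share a colour, some colour is missing there and recolouring
  -- raises the potential.
  edge-colouring : ∃[ col ] (∀ x i j → x ∈ Q i → x ∈ Q j → i ≢ j → col i ≢ col j)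
  edge-colouring = improve (n * k) initial (ℕ.m≤m+n (n * k) _)
    where
    initial : Fin N → Fin k
    -- Any colouring can start the process; a label from `δ` shows that a colour exists.
    initial i = let x , x∈ = Q-nonempty i in proj₁ (degree≤k x) i x∈

    improve : ∀ fuel col → n * k ≤ fuel + potential col →
      ∃[ col ] (∀ x i j → x ∈ Q i → x ∈ Q j → i ≢ j → col i ≢ col j)
    improve fuel col enough
      with any? (λ x → any? λ i → any? λ j →
             (x ∈? Q i) ×-dec (x ∈? Q j) ×-dec ¬? (i Fin.≟ j) ×-dec (col i Fin.≟ col j))
    ... | no ∄clash = col , λ x i j x∈i x∈j i≢j eq → ∄clash (x , i , j , x∈i , x∈j , i≢j , eq)
    ... | yes (x , i , j , clash) with missing-colour col clash
    ...   | b , b∉ with recolour col clash b∉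
    improve zero       col enough | yes _ | _ | col′ , more =
      contradiction (ℕ.<-≤-trans more (∑-bound (λ x → Subset.∣p∣≤n (seen col′ x)))) (ℕ.≤⇒≯ enough)
    improve (suc fuel) col enough | yes _ | _ | col′ , more =
      improve fuel col′ (ℕ.≤-trans enough (ℕ.≤-trans (ℕ.≤-reflexive (≡-sym (ℕ.+-suc fuel (potential col)))) (ℕ.+-monoʳ-≤ fuel more)))

-- The König property

length≤∑-fibres : ∀ {k N} (col : Fin N → Fin k) (is : List (Fin N)) →
  length is ≤ ∑ (λ b → length (filter (λ i → col i Fin.≟ b) is))
length≤∑-fibres col [] = z≤n
length≤∑-fibres col (i ∷ is) = ℕ.≤-<-trans (length≤∑-fibres col is) (∑-mono-< weak (col i) strict)
  where
  weak : ∀ b → length (filter (λ i → col i Fin.≟ b) is) ≤ length (filter (λ i → col i Fin.≟ b) (i ∷ is))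
  weak b with col i Fin.≟ b
  ... | yes _ = ℕ.n≤1+n _
  ... | no  _ = ℕ.≤-refl
  strict : length (filter (λ j → col j Fin.≟ col i) is) < length (filter (λ j → col j Fin.≟ col i) (i ∷ is))
  strict = ℕ.≤-reflexive (cong length (≡-sym (List.filter-accept (λ j → col j Fin.≟ col i) refl)))

-- Pigeonhole: fibres of size at most `ν` hold at most `k * ν` indices in total.
large-fibre : ∀ {k N ν} (col : Fin N → Fin k) → k * ν < N →
  ∃₂ λ b (g : Fin (suc ν) → Fin N) → Injective _≡_ _≡_ g × (∀ t → col (g t) ≡ b)
large-fibre {k} {N} {ν} col kν<N with any? (λ b → suc ν ≤? length (fibre b))
  where
  fibre : Fin k → List (Fin N)
  fibre b = filter (λ i → col i Fin.≟ b) (allFin N)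
... | yes (b , large) = b , (λ t → lookup fibre (inject≤ t large)) ,
        (λ eq → Fin.inject≤-injective large large _ _ (lookup-injective (Unique.filter⁺ _ (Unique.allFin⁺ N)) eq)) ,
        λ t → All.lookup (All.all-filter (λ i → col i Fin.≟ b) (allFin N)) (∈-lookup (inject≤ t large))
  where fibre = filter (λ i → col i Fin.≟ b) (allFin N)
... | no ∄large = contradiction kν<N (ℕ.≤⇒≯ (begin
        N                   ≡⟨ ≡-sym (List.length-tabulate id) ⟩
        length (allFin N)   ≤⟨ length≤∑-fibres col (allFin N) ⟩
        _                   ≤⟨ ∑-bound (λ b → ℕ.≤-pred (ℕ.≰⇒> λ le → ∄large (b , le))) ⟩
        k * ν               ∎))
  where open ℕ.≤-Reasoning

-- Weak duality: the points of `T` chosen from disjoint sets are distinct.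
disjoint-transversal : ∀ {ν} (M : Fin ν → Subset n) → (∀ {i j} → i ≢ j → Disjoint (M i) (M j)) →
  ∀ T → (∀ i → ∃[ x ] (x ∈ T × x ∈ M i)) → ν ≤ ∣ T ∣
disjoint-transversal {ν = ν} M dis T hit = subst (_≤ ∣ T ∣) (List.length-tabulate rep)
  (unique⇒length≤∣∣ T (Unique.tabulate⁺ rep-injective) (All.tabulate⁺ (proj₁ ∘ proj₂ ∘ hit)))
  where
  rep = proj₁ ∘ hit
  rep-injective : ∀ {i j} → rep i ≡ rep j → i ≡ j
  rep-injective {i} {j} eq = decidable-stable (i Fin.≟ j) λ i≢j →
    dis i≢j (rep i) (proj₂ (proj₂ (hit i))) (subst (_∈ M j) (≡-sym eq) (proj₂ (proj₂ (hit j))))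

∀⊎⇒⊎∀ : ∀ {A : Set} {B : Fin n → Set} → (∀ x → A ⊎ B x) → A ⊎ (∀ x → B x)
∀⊎⇒⊎∀ {zero}  f = inj₂ λ ()
∀⊎⇒⊎∀ {suc n} f with f zero | ∀⊎⇒⊎∀ (f ∘ suc)
... | inj₁ a | _      = inj₁ a
... | inj₂ _ | inj₁ a = inj₁ a
... | inj₂ b | inj₂ g = inj₂ λ { zero → b ; (suc i) → g i }

-- `X` discards the maximal cliques that meet it, while the others remain maximal cliques of `G`;
-- passing to an induced subgraph could create new ones.
record Matching (G : Graph n) (X : Subset n) (ν : ℕ) : Set where
  field
    clique      : Fin ν → Subset n
    maximal     : ∀ i → IsMaxClique G (clique i)
    avoids      : ∀ i → Disjoint (clique i) X
    disjoint    : ∀ {i j} → i ≢ j → Disjoint (clique i) (clique j)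
open Matching

matching-≤ : ∀ {G : Graph n} {X ν} → Matching G X ν → ν ≤ n
matching-≤ {n} M = ℕ.≤-trans
  (disjoint-transversal (clique M) (disjoint M) ⊤
    (λ i → let x , x∈ = proj₁ (proj₂ (maximal M i)) in x , Subset.∈⊤ , x∈))
  (Subset.∣p∣≤n ⊤)

-- A cover no larger than a matching certifies that both are optimal.
record KönigPair (G : Graph n) (X : Subset n) : Set where
  field
    {size}   : ℕ
    cover    : Subset n
    covers   : ∀ K → IsMaxClique G K → Disjoint K X → ∃[ x ] (x ∈ cover × x ∈ K)
    matching : Matching G X size
    ∣cover∣≤ : ∣ cover ∣ ≤ size
open KönigPair

Disjoint? : ∀ (A B : Subset n) → Dec (Disjoint A B)
Disjoint? A B = all? λ x → (x ∈? A) →-dec ¬? (x ∈? B)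

module König (G : Graph n) (df : DiamondFree G) (balanced : ∀ L → ¬ ProperOddCycle G L) where

  -- Lovász: n matchings, the x-th avoiding x, have maximum degree at most n − 1, so n − 1 colours suffice
  -- for them and one colour class is larger than the given matchings.
  augment : ∀ {X ν} → 1 ≤ ν → 1 ≤ n → (∀ x → Σ (Matching G X ν) λ M → ∀ t → x ∉ clique M t) →
    Matching G X (suc ν)
  augment {X} {ν} 1≤ν (s≤s {n = n′} z≤n) Ms =
    -- The matchings supply `suc n′ * ν` indexed members for `n′` colours; as `ν` is positive, some
    -- colour occurs more than `ν` times.
    larger (large-fibre colour (ℕ.+-monoˡ-≤ (n′ * ν) 1≤ν))
    where
    M : ∀ x → Matching G X ν
    M = proj₁ ∘ Ms
    Q : Fin (suc n′ * ν) → Subset (suc n′)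
    Q i = let x , t = remQuot ν i in clique (M x) t
    Q-max : ∀ i → IsMaxClique G (Q i)
    Q-max i = let x , t = remQuot ν i in maximal (M x) t
    base : Fin (suc n′ * ν) → Fin (suc n′)
    base i = proj₁ (remQuot ν i)
    y≢base : ∀ {y} i → y ∈ Q i → base i ≢ y
    y≢base i y∈ refl = let x , t = remQuot ν i in proj₂ (Ms x) t y∈
    same : ∀ {y} x x′ t t′ → x ≡ x′ → y ∈ clique (M x) t → y ∈ clique (M x′) t′ → (x , t) ≡ (x′ , t′)
    same {y} x _ t t′ refl y∈ y∈′ = cong (x ,_) (decidable-stable (t Fin.≟ t′) λ t≢t′ → disjoint (M x) t≢t′ y y∈ y∈′)
    degree : ∀ y → Σ (∀ i → y ∈ Q i → Fin n′) λ δ → ∀ i j p q → δ i p ≡ δ j q → i ≡ j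
    -- A member through `y` is labelled by its matching. The matching belonging to `y` avoids `y`,
    -- so one label drops out, and disjointness within a matching makes the labelling injective.
    degree y = (λ i y∈ → punchOut (y≢base i y∈ ∘ ≡-sym)) , λ i j p q eq →
      trans (≡-sym (Fin.combine-remQuot {suc n′} ν i)) (trans
        (cong (λ xt → combine (proj₁ xt) (proj₂ xt))
          (same (base i) (base j) (proj₂ (remQuot ν i)) (proj₂ (remQuot ν j))
            (Fin.punchOut-injective (y≢base i p ∘ ≡-sym) (y≢base j q ∘ ≡-sym) eq) p q))
        (Fin.combine-remQuot {suc n′} ν j))
    open EdgeColouring Q (CliqueFamily.bicolouring G df balanced Q Q-max) (λ i → proj₁ (proj₂ (Q-max i))) degree
    colour = proj₁ edge-colouring
    larger : (∃₂ λ b (g : Fin (suc ν) → Fin (suc n′ * ν)) → Injective _≡_ _≡_ g × (∀ t → colour (g t) ≡ b)) →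
      Matching G X (suc ν)
    larger (b , g , g-inj , g-col) = record
      { clique = Q ∘ g
      ; maximal = Q-max ∘ g
      ; avoids = λ t → let x , s = remQuot ν (g t) in avoids (M x) s
      ; disjoint = λ {s} {t} s≢t y y∈s y∈t →
          proj₂ edge-colouring y (g s) (g t) y∈s y∈t (s≢t ∘ g-inj) (trans (g-col s) (≡-sym (g-col t)))
      }

  module Step {X : Subset n} (smaller : ∀ x → x ∉ X → KönigPair G (X ∪ ⁅ x ⁆)) where

    -- For `x` outside `X`, the pair for `X ∪ ⁅ x ⁆` either has at least `ν` cliques, all avoiding
    -- `x`, or its cover together with `x` has at most `ν` vertices and forms a pair with `M`.
    finished-or-avoiding : ∀ {ν} → Matching G X ν → ∀ x →
      KönigPair G X ⊎ (Σ (Matching G X ν) λ M → ∀ t → x ∉ clique M t)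
    finished-or-avoiding {ν} M x with x ∈? X
    ... | yes x∈ = inj₂ (M , λ t x∈M → avoids M t x x∈M x∈)
    ... | no  x∉ with smaller x x∉
    ...   | P with ν ≤? size P
    ...     | yes ν≤ = inj₂ (restricted , λ t x∈ → avoids (matching P) (inject≤ t ν≤) x x∈ (x∈p∪q⁺ (inj₂ (x∈⁅x⁆ x))))
      where
      restricted : Matching G X ν
      restricted = record
        { clique = λ t → clique (matching P) (inject≤ t ν≤)
        ; maximal = λ t → maximal (matching P) (inject≤ t ν≤)
        ; avoids = λ t y y∈ y∈X → avoids (matching P) (inject≤ t ν≤) y y∈ (x∈p∪q⁺ (inj₁ y∈X))
        ; disjoint = λ s≢t → disjoint (matching P) (s≢t ∘ Fin.inject≤-injective ν≤ ν≤ _ _) }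
    ...     | no ν≰ = inj₁ record { cover = cover P ∪ ⁅ x ⁆ ; covers = covers′ ; matching = M ; ∣cover∣≤ = bound }
      where
      covers′ : ∀ K → IsMaxClique G K → Disjoint K X → ∃[ y ] (y ∈ cover P ∪ ⁅ x ⁆ × y ∈ K)
      covers′ K mK K#X with x ∈? K
      ... | yes x∈ = x , x∈p∪q⁺ (inj₂ (x∈⁅x⁆ x)) , x∈
      ... | no x∉K with covers P K mK (λ y y∈K y∈ → case x∈p∪q⁻ X _ y∈ of λ where
              (inj₁ y∈X) → K#X y y∈K y∈X
              (inj₂ y∈x) → x∉K (subst (_∈ K) (x∈⁅y⁆⇒x≡y x y∈x) y∈K))
      ...   | y , y∈cover , y∈K = y , x∈p∪q⁺ (inj₁ y∈cover) , y∈K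
      bound : ∣ cover P ∪ ⁅ x ⁆ ∣ ≤ ν
      bound = begin
        ∣ cover P ∪ ⁅ x ⁆ ∣        ≤⟨ ∣p∪q∣≤∣p∣+∣q∣ (cover P) ⁅ x ⁆ ⟩
        ∣ cover P ∣ + ∣ ⁅ x ⁆ ∣    ≡⟨ cong (∣ cover P ∣ +_) (Subset.∣⁅x⁆∣≡1 x) ⟩
        ∣ cover P ∣ + 1            ≡⟨ ℕ.+-comm ∣ cover P ∣ 1 ⟩
        suc ∣ cover P ∣            ≤⟨ s≤s (∣cover∣≤ P) ⟩
        suc (size P)               ≤⟨ ℕ.≰⇒> ν≰ ⟩
        ν                          ∎
        where open ℕ.≤-Reasoning

    -- As long as no vertex yields a pair, each vertex is avoided by some matching of size `ν`, so
    -- `augment` applies; no matching exceeds `n` cliques.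
    grow : ∀ fuel {ν} → 1 ≤ ν → 1 ≤ n → Matching G X ν → n ≤ fuel + ν → KönigPair G X
    grow fuel 1≤ν 1≤n M enough with ∀⊎⇒⊎∀ (finished-or-avoiding M)
    ... | inj₁ done = done
    ... | inj₂ Ms with augment 1≤ν 1≤n Ms
    grow zero       1≤ν 1≤n M enough | inj₂ _ | M′ = contradiction (matching-≤ M′) (ℕ.≤⇒≯ enough)
    grow (suc fuel) {ν} 1≤ν 1≤n M enough | inj₂ _ | M′ =
      grow fuel (s≤s z≤n) 1≤n M′ (subst (n ≤_) (≡-sym (ℕ.+-suc fuel ν)) enough)

  ∣X∣<∣X∪⁅x⁆∣ : ∀ {X : Subset n} {x} → x ∉ X → ∣ X ∣ < ∣ X ∪ ⁅ x ⁆ ∣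
  ∣X∣<∣X∪⁅x⁆∣ {X} {x} x∉ = Subset.p⊂q⇒∣p∣<∣q∣ ((λ y∈ → x∈p∪q⁺ (inj₁ y∈)) , x , x∈p∪q⁺ (inj₂ (x∈⁅x⁆ x)) , x∉)

  -- Induction on the number of vertices outside `X`, bounded by `fuel`. The matching to be enlarged
  -- starts as a single clique.
  königPair : ∀ X → KönigPair G X
  königPair X = go n X (ℕ.m≤m+n n _)
    where
    go : ∀ fuel X → n ≤ fuel + ∣ X ∣ → KönigPair G X
    go fuel X enough with anySubset? (λ K → IsMaxClique? G K ×-dec Disjoint? K X)
    ... | no ∄K = record
            { cover = ∅
            ; covers = λ K mK K#X → contradiction (K , mK , K#X) ∄K
            ; matching = record { clique = λ () ; maximal = λ () ; avoids = λ () ; disjoint = λ { {()} } }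
            ; ∣cover∣≤ = ℕ.≤-reflexive (Subset.∣⊥∣≡0 n) }
    go zero X enough | yes (K , (_ , (x , x∈) , _) , K#X) =
      contradiction (ℕ.<-≤-trans (∣X∣<∣X∪⁅x⁆∣ (K#X x x∈)) (Subset.∣p∣≤n (X ∪ ⁅ x ⁆))) (ℕ.≤⇒≯ enough)
    go (suc fuel) X enough | yes (K , mK , K#X) =
      Step.grow smaller n (s≤s z≤n) (ℕ.≤-trans (s≤s z≤n) (toℕ<n (proj₁ (proj₁ (proj₂ mK))))) single (ℕ.m≤m+n n 1)
      where
      smaller : ∀ x → x ∉ X → KönigPair G (X ∪ ⁅ x ⁆)
      smaller x x∉ = go fuel (X ∪ ⁅ x ⁆) (ℕ.≤-trans enough
        (ℕ.≤-trans (ℕ.≤-reflexive (≡-sym (ℕ.+-suc fuel ∣ X ∣))) (ℕ.+-monoʳ-≤ fuel (∣X∣<∣X∪⁅x⁆∣ x∉))))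
      single : Matching G X 1
      single = record
        { clique = λ _ → K ; maximal = λ _ → mK ; avoids = λ _ → K#X
        ; disjoint = λ { {zero} {zero} 0≢0 → contradiction refl 0≢0 } }

  τ≡α : ∃[ k ] (τc≡ G k × αc≡ G k)
  τ≡α = size P , ((cover P , transversal , ℕ.≤-antisym (∣cover∣≤ P) (duality (cover P) transversal)) , duality) ,
    ((tabulate (clique M) , (All.tabulate⁺ (maximal M) , AllPairs.tabulate⁺ (disjoint M)) , List.length-tabulate (clique M)) ,
     independent-≤)
    where
    P = königPair ∅
    M = matching P
    transversal : IsCliqueTransversal G (cover P)
    transversal K mK = covers P K mK λ _ _ → Subset.∉⊥
    duality : ∀ T → IsCliqueTransversal G T → size P ≤ ∣ T ∣
    duality T trv = disjoint-transversal (clique M) (disjoint M) T λ i → trv (clique M i) (maximal M i)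
    disjoint-lookup : ∀ {Ks : List (Subset n)} → AllPairs Disjoint Ks → ∀ {i j} → i ≢ j → Disjoint (lookup Ks i) (lookup Ks j)
    disjoint-lookup (K# ∷ dis) {zero}  {zero}  0≢0     = contradiction refl 0≢0
    disjoint-lookup (K# ∷ dis) {zero}  {suc j} _       = All.lookup K# (∈-lookup j)
    disjoint-lookup (K# ∷ dis) {suc i} {zero}  _ x x∈ x∈′ = All.lookup K# (∈-lookup i) x x∈′ x∈
    disjoint-lookup (K# ∷ dis) {suc i} {suc j} i≢j     = disjoint-lookup dis (i≢j ∘ cong suc)
    independent-≤ : ∀ Ks → IsCliqueIndependent G Ks → length Ks ≤ size P
    independent-≤ Ks (mKs , dis) = ℕ.≤-trans
      (disjoint-transversal (lookup Ks) (disjoint-lookup dis) (cover P)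
        (λ i → transversal (lookup Ks i) (All.lookup mKs (∈-lookup i))))
      (∣cover∣≤ P)

balanced⇒cliquePerfect : (G : Graph n) → DiamondFree G → (∀ L → ¬ ProperOddCycle G L) → CliquePerfect G
balanced⇒cliquePerfect G df balanced m f f-inj = König.τ≡α (induced G f)
  (λ a b c d (a≢b , rest) → df (f a) (f b) (f c) (f d) (a≢b ∘ f-inj , rest))
  (λ L cyc → balanced (map f L) (properOddCycle-map G f-inj cyc))

-- Shortest proper odd cycles are sunoids

first-after : {P : ℕ → Set} → Decidable P → ∀ {p q} → p < q → P q →
  ∃[ s ] (p < s × s ≤ q × P s × (∀ {r} → p < r → r < s → ¬ P r))
first-after {P} P? {p} {q} p<q Pq with search (q ∸ suc p) (subst P (≡-sym (ℕ.m∸n+n≡m p<q)) Pq)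
  where
  search : ∀ d {p} → P (d + suc p) → ∃[ s ] (p < s × s ≤ d + suc p × P s × (∀ {r} → p < r → r < s → ¬ P r))
  search zero    {p} Pq = suc p , ℕ.≤-refl , ℕ.≤-refl , Pq , λ p<r r≤p _ → ℕ.<⇒≱ p<r (ℕ.≤-pred r≤p)
  search (suc d) {p} Pq with P? (suc p)
  ... | yes P1+p = suc p , ℕ.≤-refl , ℕ.m≤n+m (suc p) (suc d) , P1+p , λ p<r r≤p _ → ℕ.<⇒≱ p<r (ℕ.≤-pred r≤p)
  ... | no ¬P1+p with search d (subst P (≡-sym (ℕ.+-suc d (suc p))) Pq)
  ...   | s , p<s , s≤q , Ps , none = s , ℕ.<⇒≤ p<s , ℕ.≤-trans s≤q (ℕ.≤-reflexive (ℕ.+-suc d (suc p))) , Ps , none′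
    where
    none′ : ∀ {r} → p < r → r < s → ¬ P r
    none′ p<r r<s Pr with ℕ.m≤n⇒m<n∨m≡n p<r
    ... | inj₁ 1+p<r = none 1+p<r r<s Pr
    ... | inj₂ refl  = ¬P1+p Pr
... | s , p<s , s≤q , Ps , none = s , p<s , ℕ.≤-trans s≤q (ℕ.≤-reflexive (ℕ.m∸n+n≡m p<q)) , Ps , none

last-before : {P : ℕ → Set} → Decidable P → ∀ {p q} → p < q → P p →
  ∃[ s ] (p ≤ s × s < q × P s × (∀ {r} → s < r → r < q → ¬ P r))
last-before P? {p} {suc q} (s≤s p≤q) Pp with P? q
... | yes Pq = q , p≤q , ℕ.≤-refl , Pq , λ s<r r<q _ → ℕ.<⇒≱ s<r (ℕ.≤-pred r<q)
... | no ¬Pq with ℕ.m≤n⇒m<n∨m≡n p≤q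
...   | inj₂ refl = contradiction Pp ¬Pq
...   | inj₁ p<q with last-before P? p<q Pp
...     | s , p≤s , s<q , Ps , none = s , p≤s , ℕ.m≤n⇒m≤1+n s<q , Ps , none′
  where
  none′ : ∀ {r} → s < r → r < suc q → ¬ _
  none′ s<r (s≤s r≤q) Pr with ℕ.m≤n⇒m<n∨m≡n r≤q
  ... | inj₁ r<q  = none s<r r<q Pr
  ... | inj₂ refl = ¬Pq Pr

unique-reverse : ∀ {A : Set} {xs : List A} → Unique xs → Unique (reverse xs)
unique-reverse {A} {xs} = Permutation.Unique-resp-↭ (setoid A) (Permutation.↭-sym (setoid A) (Permutation.↭-reverse (setoid A) xs))

-- The parity of a distance, written as a sum to be symmetric, additive and free of truncated
-- subtraction.
gap : ℕ → ℕ → Parity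
gap p q = parity p ℙ.+ parity q

gap-∸ : ∀ {p q} → p ≤ q → parity (q ∸ p) ≡ gap p q
gap-∸ {p} {q} p≤q = solve (parity (q ∸ p)) (parity p) (parity q)
  (trans (≡-sym (ℙ.+-homo-+ (q ∸ p) p)) (cong parity (ℕ.m∸n+n≡m p≤q)))
  where
  solve : ∀ x y z → x ℙ.+ y ≡ z → x ≡ y ℙ.+ z
  solve 0ℙ 0ℙ _ refl = refl
  solve 0ℙ 1ℙ _ refl = refl
  solve 1ℙ 0ℙ _ refl = refl
  solve 1ℙ 1ℙ _ refl = refl

⁻¹-+-⁻¹≡0 : ∀ {x y} → x ⁻¹ ℙ.+ y ⁻¹ ≡ 0ℙ → x ≡ y
⁻¹-+-⁻¹≡0 {0ℙ} {0ℙ} _ = refl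
⁻¹-+-⁻¹≡0 {1ℙ} {1ℙ} _ = refl

≢1⇒≡0 : ∀ {p} → p ≢ 1ℙ → p ≡ 0ℙ
≢1⇒≡0 {0ℙ} _   = refl
≢1⇒≡0 {1ℙ} neq = contradiction refl neq

inSome-true : ∀ {D : List (Subset n)} x y → Any (λ K → x ∈ K × y ∈ K) D → inSome D x y ≡ true
inSome-true x y (here (x∈ , y∈)) rewrite Vec.[]=⇒lookup x∈ | Vec.[]=⇒lookup y∈ = refl
inSome-true {D = K ∷ D} x y (there any) rewrite inSome-true x y any = Bool.∨-zeroʳ _

inSome-false : ∀ {D : List (Subset n)} x y → ¬ Any (λ K → x ∈ K × y ∈ K) D → inSome D x y ≡ false
inSome-false {D = []} x y ∄K = refl
inSome-false {D = K ∷ D} x y ∄K with Vec.lookup K x in eqx | Vec.lookup K y in eqy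
... | false | _     = inSome-false x y (∄K ∘ there)
... | true  | false = inSome-false x y (∄K ∘ there)
... | true  | true  = contradiction (here (Vec.lookup⇒[]= x K eqx , Vec.lookup⇒[]= y K eqy)) ∄K

-- `H` stands for the subgraph induced by the cycle, labelled along it. All its vertices are on the
-- cycle, so properness excludes every common neighbour of a rim edge.
module ShortestCycle {m : ℕ} .{{nz : NonZero m}} (H : Graph m) (df : DiamondFree H) (m-odd : parity m ≡ 1ℙ)
  (rim-proper : ∀ {x y} → RimSucc m x y → Edge H x y × (∀ w → Edge H w x → Edge H w y → ⊥))
  (shortest : ∀ L → length L < m → ¬ ProperOddCycle H L) where

  RimEdge : Fin m → Fin m → Set
  RimEdge x y = Edge H x y × (∀ w → Edge H w x → Edge H w y → ⊥)

  RimEdge-sym : ∀ {x y} → RimEdge x y → RimEdge y x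
  RimEdge-sym (e , none) = Edge-sym H e , λ w wy wx → none w wx wy

  RimEdge⇒Proper : ∀ {L x y} → RimEdge x y → Proper H L x y
  RimEdge⇒Proper (e , none) = e , λ {w} _ → none w

  rim-neighbour : ∀ x → Edge H (next x) x
  rim-neighbour x = Edge-sym H (proj₁ (rim-proper (next-succ x)))

  -- By diamond-freeness any triangle on `uv` lies inside `K`, where `L` offers only the two ends.
  clique-proper : ∀ {K L u v} → IsMaxClique H K → u ∈ K → v ∈ K → u ≢ v →
    (∀ {w} → w ∈ˡ L → w ∈ K → w ≡ u ⊎ w ≡ v) → Proper H L u v
  clique-proper {K} {L} {u} {v} mK u∈ v∈ u≢v only = proj₁ mK u v u∈ v∈ u≢v , third
    where
    third : ∀ {w} → w ∈ˡ L → Edge H w u → Edge H w v → ⊥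
    third w∈ wu wv with only w∈ (common-neighbour∈ H df mK u∈ v∈ u≢v wu wv)
    ... | inj₁ refl = Edge⇒≢ H wu refl
    ... | inj₂ refl = Edge⇒≢ H wv refl

  third : ∀ {K x y} → Inscribed H K → x ∈ K → y ∈ K → ∃[ w ] (w ∈ K × w ≢ x × w ≢ y)
  third {x = x} (mK , size) x∈ y∈ = maxClique-third H mK size x∈ y∈ (rim-neighbour x)

  -- A third vertex of the clique would close a triangle on the rim edge.
  nonconsecutive : ∀ {K x y} → Inscribed H K → x ∈ K → y ∈ K → ¬ RimSucc m x y
  nonconsecutive inK@(mK , _) x∈ y∈ s with third inK x∈ y∈
  ... | w , w∈ , w≢x , w≢y =
    proj₂ (rim-proper s) w (proj₁ mK w _ w∈ x∈ w≢x) (proj₁ mK w _ w∈ y∈ w≢y)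

  -- Segments of the rim and the chords that close them

  segment : ℕ → ℕ → List (Fin m)
  segment p q = applyUpTo (λ i → rim (i + p)) (suc (q ∸ p))

  segment-path : ∀ {p q} → p ≤ q → Path RimEdge (rim p) (segment p q) (rim q)
  segment-path {p} {q} p≤q = subst (λ z → Path RimEdge (rim p) (segment p q) (rim z)) (ℕ.m∸n+n≡m p≤q)
    (path-applyUpTo (λ i → rim (i + p)) (q ∸ p) (λ {i} _ → rim-proper (rim-step (i + p))))

  ∈-segment : ∀ {p q w} → p ≤ q → w ∈ˡ segment p q → ∃[ r ] (p ≤ r × r ≤ q × w ≡ rim r)
  ∈-segment {p} {q} p≤q w∈ with ∈ˡ.∈-applyUpTo⁻ (λ i → rim (i + p)) w∈
  ... | i , s≤s i≤ , eq = i + p , ℕ.m≤n+m p i ,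
    ℕ.≤-trans (ℕ.+-monoˡ-≤ p i≤) (ℕ.≤-reflexive (ℕ.m∸n+n≡m p≤q)) , eq

  ∈-segment-ends : ∀ {P : Fin m → Set} {p q w} → p ≤ q → (∀ {r} → p < r → r < q → ¬ P (rim r)) →
    w ∈ˡ segment p q → P w → w ≡ rim p ⊎ w ≡ rim q
  ∈-segment-ends p≤q none w∈ Pw with ∈-segment p≤q w∈
  ... | r , p≤r , r≤q , refl with ℕ.m≤n⇒m<n∨m≡n p≤r | ℕ.m≤n⇒m<n∨m≡n r≤q
  ...   | inj₂ refl | _         = inj₁ refl
  ...   | inj₁ _    | inj₂ refl = inj₂ refl
  ...   | inj₁ p<r  | inj₁ r<q  = contradiction Pw (none p<r r<q)

  segment-unique : ∀ {p q} → p ≤ q → q < p + m → Unique (segment p q)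
  segment-unique {p} {q} p≤q q< = Unique.applyUpTo⁺₁ (λ i → rim (i + p)) (suc (q ∸ p)) λ {i} {j} i<j j≤ →
    rim-injective (ℕ.+-monoˡ-< p i<j) (ℕ.<-≤-trans (ℕ.≤-<-trans
      (ℕ.≤-trans (ℕ.+-monoˡ-≤ p (ℕ.≤-pred j≤)) (ℕ.≤-reflexive (ℕ.m∸n+n≡m p≤q))) q<)
      (ℕ.+-monoˡ-≤ m (ℕ.m≤n+m p i)))

  segment-parity : ∀ {p q} → p ≤ q → parity (length (segment p q)) ≡ gap p q ⁻¹
  segment-parity {p} {q} p≤q = trans (cong parity (List.length-applyUpTo (λ i → rim (i + p)) (suc (q ∸ p))))
    (trans (parity-suc (q ∸ p)) (cong _⁻¹ (gap-∸ p≤q)))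

  segment-length : ∀ {p q} → p ≤ q → q < p + m → suc q ≢ p + m → length (segment p q) < m
  segment-length {p} {q} p≤q q< neq = subst (_< m) (≡-sym (List.length-applyUpTo (λ i → rim (i + p)) (suc (q ∸ p))))
    (ℕ.+-cancelʳ-< p _ _ (subst (_< m + p) (cong suc (≡-sym (ℕ.m∸n+n≡m p≤q)))
      (subst (suc q <_) (ℕ.+-comm p m) (ℕ.≤∧≢⇒< q< neq))))

  -- A chord of the rim closing a segment with an odd number of vertices gives a shorter proper odd cycle,
  -- unless the chord is itself a rim edge.
  even-chord : ∀ {K p q} → IsMaxClique H K → p < q → q < p + m → rim p ∈ K → rim q ∈ K →
    (∀ {r} → p < r → r < q → rim r ∉ K) → gap p q ≡ 0ℙ → suc q ≡ p + m
  even-chord {K} {p} {q} mK p<q q< p∈ q∈ none even = decidable-stable (suc q ℕ.≟ p + m) λ neq →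
    shortest (segment p q) (segment-length p≤q q< neq)
      (rim p , rim q , path-weaken RimEdge⇒Proper (segment-path p≤q) ,
       clique-proper mK q∈ p∈ (rim-injective p<q q< ∘ ≡-sym) only , segment-unique p≤q q< ,
       trans (segment-parity p≤q) (cong _⁻¹ even))
    where
    p≤q = ℕ.<⇒≤ p<q
    only : ∀ {w} → w ∈ˡ segment p q → w ∈ K → w ≡ rim q ⊎ w ≡ rim p
    only w∈ w∈K = Sum.swap (∈-segment-ends p≤q none w∈ w∈K)

  -- Two complementary arcs add up to the odd number `m`.
  gap-period : ∀ p q → gap q (p + m) ≡ gap p q ⁻¹
  gap-period p q = trans (cong (parity q ℙ.+_) (trans (ℙ.+-homo-+ p m) (cong (parity p ℙ.+_) m-odd)))
    (solve (parity p) (parity q))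
    where
    solve : ∀ x y → y ℙ.+ (x ℙ.+ 1ℙ) ≡ (x ℙ.+ y) ⁻¹
    solve 0ℙ 0ℙ = refl
    solve 0ℙ 1ℙ = refl
    solve 1ℙ 0ℙ = refl
    solve 1ℙ 1ℙ = refl

  rim-period-∈ : ∀ {K p} → rim p ∈ K → rim (p + m) ∈ K
  rim-period-∈ {K} {p} = subst (_∈ K) (≡-sym (rim-period p))

  rim-period-∈⁻ : ∀ {K p} → rim (p + m) ∈ K → rim p ∈ K
  rim-period-∈⁻ {K} {p} = subst (_∈ K) (rim-period p)

  -- `q` is at most `p + m`, where `K` is met again. A full turn is odd; over a shorter distance, an
  -- even gap would make the chord a rim edge by `even-chord`.
  odd-gap : ∀ {K p q} → Inscribed H K → p < q → rim p ∈ K → rim q ∈ K →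
    (∀ {r} → p < r → r < q → rim r ∉ K) → gap p q ≡ 1ℙ
  odd-gap {K} {p} {q} inK p<q p∈ q∈ none with ℕ.<-cmp q (p + m)
  ... | tri> _ _ p+m<q = contradiction (rim-period-∈ p∈) (none (ℕ.m<m+n p (>-nonZero⁻¹ m)) p+m<q)
  ... | tri≈ _ refl _ = trans (gap-period p p) (cong _⁻¹ (p+p≡0 (parity p)))
  ... | tri< q< _ _ with gap p q in eq
  ...   | 1ℙ = refl
  ...   | 0ℙ = contradiction
          (subst (λ z → RimSucc m (rim q) (rim z)) (even-chord (proj₁ inK) p<q q< p∈ q∈ none eq) (rim-step q))
          (nonconsecutive inK q∈ (rim-period-∈ p∈))

  -- One of the two arcs between `x` and `y` is even, so by `even-chord` the other is a single rim
  -- edge.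
  two-element-cliques-on-rim : ∀ x y → x ≢ y → IsMaxClique H (⁅ x ⁆ ∪ ⁅ y ⁆) → RimAdj m x y
  two-element-cliques-on-rim x y x≢y mK = subst (λ z → RimAdj m z y) (rim-toℕ x) (go (rim-surjective p y))
    where
    p = toℕ x
    x∈ : rim p ∈ ⁅ x ⁆ ∪ ⁅ y ⁆
    x∈ = subst (_∈ ⁅ x ⁆ ∪ ⁅ y ⁆) (≡-sym (rim-toℕ x)) x∈⁅x,y⁆
    go : ∃[ q ] (p ≤ q × q < p + m × rim q ≡ y) → RimAdj m (rim p) y
    go (q , p≤q , q< , refl) with gap p q in eq
    ... | 0ℙ = inj₂ (subst (RimSucc m (rim q)) (trans (cong rim suc-q≡p+m) (rim-period p)) (rim-step q))
      where
      p<q = ℕ.≤∧≢⇒< p≤q λ { refl → x≢y (≡-sym (rim-toℕ x)) }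
      suc-q≡p+m = even-chord mK p<q q< x∈ y∈⁅x,y⁆ (λ p<r r<q r∈ → case pair-members r∈ of λ where
        (inj₁ r≡x) → rim-injective p<r (ℕ.<-trans r<q q<) (trans (rim-toℕ x) (≡-sym r≡x))
        (inj₂ r≡y) → rim-injective r<q (ℕ.<-≤-trans q< (ℕ.+-monoˡ-≤ m (ℕ.<⇒≤ p<r))) r≡y) eq
    ... | 1ℙ = inj₁ (subst (λ z → RimSucc m (rim p) (rim z)) suc-p≡q (rim-step p))
      where
      p<q = ℕ.≤∧≢⇒< p≤q λ { refl → x≢y (≡-sym (rim-toℕ x)) }
      suc-p≡q : suc p ≡ q
      suc-p≡q = ℕ.+-cancelʳ-≡ m _ _ (even-chord mK q< (ℕ.+-monoˡ-< m p<q) y∈⁅x,y⁆ (rim-period-∈ x∈)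
        (λ q<r r<p+m r∈ → case pair-members r∈ of λ where
          (inj₁ r≡x) → rim-injective (ℕ.<-trans p<q q<r) r<p+m (trans (rim-toℕ x) (≡-sym r≡x))
          (inj₂ r≡y) → rim-injective q<r (ℕ.<-trans r<p+m (ℕ.+-monoˡ-< m p<q)) (≡-sym r≡y))
        (trans (gap-period p q) (cong _⁻¹ eq)))

  -- `v` is the membership vector of `A` at the `k` positions from `j` on, so that recursion on it
  -- counts members along the rim.
  Suffix : ∀ {k} → Subset m → Vec.Vec Bool k → ℕ → Set
  Suffix {k} A v j = ∀ i → (Vec.lookup v i ≡ true → rim (toℕ {k} i + j) ∈ A) × (rim (toℕ i + j) ∈ A → Vec.lookup v i ≡ true)

  Suffix-tail : ∀ {A k b} {v : Vec.Vec Bool k} {j} → Suffix A (b ∷ v) j → Suffix A v (suc j)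
  Suffix-tail {A} {v = v} {j} suf i = subst (λ z → (Vec.lookup v i ≡ true → rim z ∈ A) × (rim z ∈ A → Vec.lookup v i ≡ true))
    (≡-sym (ℕ.+-suc (toℕ i) j)) (suf (suc i))

  -- From `ℓ`, the last member before `j`, to `e`, the first one from `k + j` on, there are
  -- `∣ v ∣ + 1` gaps, each odd by `odd-gap`.
  gap-count : ∀ {A k} (v : Vec.Vec Bool k) {j ℓ e} → Inscribed H A → Suffix A v j →
    ℓ < j → rim ℓ ∈ A → (∀ {r} → ℓ < r → r < j → rim r ∉ A) →
    k + j ≤ e → rim e ∈ A → (∀ {r} → k + j ≤ r → r < e → rim r ∉ A) →
    gap ℓ e ≡ parity ∣ v ∣ ⁻¹
  gap-count [] {j} inA suf ℓ<j ℓ∈ none j≤e e∈ none′ = odd-gap inA (ℕ.<-≤-trans ℓ<j j≤e) ℓ∈ e∈ between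
    where
    between : ∀ {r} → _ < r → r < _ → rim r ∉ _
    between {r} ℓ<r r<e with r <? j
    ... | yes r<j = none ℓ<r r<j
    ... | no  r≮j = none′ (ℕ.≮⇒≥ r≮j) r<e
  gap-count {A} {suc k} (false ∷ v) {j} inA suf ℓ<j ℓ∈ none k≤e e∈ none′ =
    gap-count v inA (Suffix-tail suf) (ℕ.m≤n⇒m≤1+n ℓ<j) ℓ∈ between
      (ℕ.≤-trans (ℕ.≤-reflexive (ℕ.+-suc k j)) k≤e) e∈ (none′ ∘ ℕ.≤-trans (ℕ.≤-reflexive (≡-sym (ℕ.+-suc k j))))
    where
    between : ∀ {r} → _ < r → r < suc j → rim r ∉ A
    between ℓ<r (s≤s r≤j) r∈ with ℕ.m≤n⇒m<n∨m≡n r≤j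
    ... | inj₁ r<j  = none ℓ<r r<j r∈
    ... | inj₂ refl = contradiction (proj₂ (suf zero) r∈) λ ()
  gap-count {A} {suc k} (true ∷ v) {j} {ℓ} {e} inA suf ℓ<j ℓ∈ none k≤e e∈ none′ =
    trans (solve (parity ℓ) (parity j) (parity e) (odd-gap inA ℓ<j ℓ∈ j∈ none))
      (cong _⁻¹ (trans (gap-count v inA (Suffix-tail suf) ℕ.≤-refl j∈ (λ j<r r≤j → contradiction j<r (ℕ.≤⇒≯ (ℕ.≤-pred r≤j)))
        (ℕ.≤-trans (ℕ.≤-reflexive (ℕ.+-suc k j)) k≤e) e∈ (none′ ∘ ℕ.≤-trans (ℕ.≤-reflexive (≡-sym (ℕ.+-suc k j)))))
        (≡-sym (parity-suc ∣ v ∣))))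
    where
    j∈ = proj₁ (suf zero) refl
    solve : ∀ x y z → x ℙ.+ y ≡ 1ℙ → x ℙ.+ z ≡ (y ℙ.+ z) ⁻¹
    solve 0ℙ 1ℙ 0ℙ _ = refl
    solve 0ℙ 1ℙ 1ℙ _ = refl
    solve 1ℙ 0ℙ 0ℙ _ = refl
    solve 1ℙ 0ℙ 1ℙ _ = refl

  -- One turn starting at the first member of `A` consists of `∣ A ∣` odd gaps with the odd total
  -- `m`.
  odd-size : ∀ {A} → Inscribed H A → Odd ∣ A ∣
  odd-size {A} inA@((_ , (x , x∈) , _) , _) = parity≡1⇒Odd ∣ A ∣ (scan A suffix (λ ()) (ℕ.+-identityʳ m))
    where
    suffix : Suffix A A 0
    suffix i = (λ eq → subst (_∈ A) (≡-sym i≡) (Vec.lookup⇒[]= i A eq)) , λ i∈ → Vec.[]=⇒lookup (subst (_∈ A) i≡ i∈)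
      where
      i≡ : rim (toℕ i + 0) ≡ i
      i≡ = trans (cong rim (ℕ.+-identityʳ (toℕ i))) (rim-toℕ i)
    scan : ∀ {k} (v : Vec.Vec Bool k) {j} → Suffix A v j → (∀ {r} → r < j → rim r ∉ A) → k + j ≡ m → parity ∣ v ∣ ≡ 1ℙ
    scan [] suf none refl = contradiction (subst (_∈ A) (≡-sym (rim-toℕ x)) x∈) (none (toℕ<n x))
    scan {suc k} (false ∷ v) {j} suf none eq = scan v (Suffix-tail suf) none′ (trans (ℕ.+-suc k j) eq)
      where
      none′ : ∀ {r} → r < suc j → rim r ∉ A
      none′ (s≤s r≤j) r∈ with ℕ.m≤n⇒m<n∨m≡n r≤j
      ... | inj₁ r<j  = none r<j r∈
      ... | inj₂ refl = contradiction (proj₂ (suf zero) r∈) λ ()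
    scan {suc k} (true ∷ v) {j} suf none eq = trans (parity-suc ∣ v ∣) (trans (≡-sym count)
      (trans (gap-period j j) (cong _⁻¹ (p+p≡0 (parity j)))))
      where
      k+1+j≡m : k + suc j ≡ m
      k+1+j≡m = trans (ℕ.+-suc k j) eq
      j∈ = proj₁ (suf zero) refl
      wrap : ∀ {r} → k + suc j ≤ r → r < j + m → rim r ∉ A
      wrap {r} m≤r r< r∈ = none {r ∸ m}
        (ℕ.+-cancelʳ-< m _ _ (subst (_< j + m) (≡-sym (ℕ.m∸n+n≡m m≤r′)) r<))
        (rim-period-∈⁻ (subst (λ z → rim z ∈ A) (≡-sym (ℕ.m∸n+n≡m m≤r′)) r∈))
        where m≤r′ = subst (_≤ r) k+1+j≡m m≤r
      count : gap j (j + m) ≡ parity ∣ v ∣ ⁻¹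
      count = gap-count v inA (Suffix-tail suf) ℕ.≤-refl j∈ (λ j<r r≤j → contradiction j<r (ℕ.≤⇒≯ (ℕ.≤-pred r≤j)))
        (subst (_≤ j + m) (≡-sym k+1+j≡m) (ℕ.m≤n+m m j)) (rim-period-∈ j∈) wrap

  -- An even `L` would close up through `ξ` to a proper odd cycle, shorter than the rim because it
  -- misses a third vertex of `A`.
  odd-path-between-cliques : ∀ {A B ξ x y L} → Inscribed H A → Inscribed H B → ξ ∈ A → ξ ∈ B →
    Path RimEdge x L y → Unique L → x ∈ A → y ∈ B → ξ ∉ˡ L → x ∈ˡ L → y ∈ˡ L →
    (∀ {w} → w ∈ˡ L → w ∈ A → w ≡ x) → (∀ {w} → w ∈ˡ L → w ∈ B → w ≡ y) → parity (length L) ≡ 1ℙ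
  odd-path-between-cliques {ξ = ξ} {x} {y} {L} inA inB ξ∈A ξ∈B path uniq x∈A y∈B ξ∉L x∈L y∈L onlyA onlyB
    with parity (length L) in eq
  ... | 1ℙ = refl
  ... | 0ℙ with third inA ξ∈A x∈A
  ...   | w , w∈A , w≢ξ , w≢x = ⊥-elim (shortest (ξ ∷ L) (unique⇒length< ξL-unique w∉)
    (ξ , y , clique-proper (proj₁ inA) ξ∈A x∈A (λ { refl → ξ∉L x∈L }) onlyA′ ∷ path-weaken RimEdge⇒Proper path ,
     clique-proper (proj₁ inB) y∈B ξ∈B (λ { refl → ξ∉L y∈L }) onlyB′ , ξL-unique ,
     trans (parity-suc (length L)) (cong _⁻¹ eq)))
    where
    w∉ : w ∉ˡ ξ ∷ L
    w∉ (here w≡ξ)  = w≢ξ w≡ξ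
    w∉ (there w∈L) = w≢x (onlyA w∈L w∈A)
    ξL-unique : Unique (ξ ∷ L)
    ξL-unique = All.tabulate (λ z∈ ξ≡z → ξ∉L (subst (_∈ˡ L) (≡-sym ξ≡z) z∈)) ∷ uniq
    onlyA′ : ∀ {z} → z ∈ˡ ξ ∷ L → z ∈ _ → z ≡ ξ ⊎ z ≡ x
    onlyA′ (here z≡ξ) _  = inj₁ z≡ξ
    onlyA′ (there z∈) z∈A = inj₂ (onlyA z∈ z∈A)
    onlyB′ : ∀ {z} → z ∈ˡ ξ ∷ L → z ∈ _ → z ≡ y ⊎ z ≡ ξ
    onlyB′ (here z≡ξ) _  = inj₂ z≡ξ
    onlyB′ (there z∈) z∈B = inj₁ (onlyB z∈ z∈B)

  -- The two paths, a chord in `B` and a chord in `A` form a proper cycle. It misses a third vertex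
  -- of `A`, so it is shorter than the rim and cannot be odd.
  two-chord-cycle : ∀ {A B x y L y′ x′ L′} → Inscribed H A → Inscribed H B →
    Path RimEdge x L y → Path RimEdge y′ L′ x′ → x ∈ A → x′ ∈ A → y ∈ B → y′ ∈ B → x ≢ x′ → y ≢ y′ →
    Unique (L ++ L′) →
    (∀ {w} → w ∈ˡ L ++ L′ → w ∈ A → w ≡ x ⊎ w ≡ x′) → (∀ {w} → w ∈ˡ L ++ L′ → w ∈ B → w ≡ y ⊎ w ≡ y′) →
    parity (length L) ℙ.+ parity (length L′) ≡ 0ℙ
  two-chord-cycle {x = x} {y} {L} {y′} {x′} {L′} inA inB path path′ x∈A x′∈A y∈B y′∈B x≢x′ y≢y′ uniq onlyA onlyB
    with third inA x∈A x′∈A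
  ... | w , w∈A , w≢x , w≢x′ = ≢1⇒≡0 λ odd → shortest (L ++ L′) (unique⇒length< uniq w∉)
    (x , x′ , path-++ (path-weaken RimEdge⇒Proper path) (clique-proper (proj₁ inB) y∈B y′∈B y≢y′ onlyB)
      (path-weaken RimEdge⇒Proper path′) ,
     clique-proper (proj₁ inA) x′∈A x∈A (x≢x′ ∘ ≡-sym) (λ z∈ z∈A → Sum.swap (onlyA z∈ z∈A)) , uniq ,
     trans (cong parity (List.length-++ L)) (trans (ℙ.+-homo-+ (length L) (length L′)) odd))
    where
    w∉ : w ∉ˡ L ++ L′
    w∉ w∈ with onlyA w∈ w∈A
    ... | inj₁ w≡x  = w≢x w≡x
    ... | inj₂ w≡x′ = w≢x′ w≡x′

  -- Inscribed cliques are not disjoint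

  module DisjointCliques {A B : Subset m} (inA : Inscribed H A) (inB : Inscribed H B) (A#B : Disjoint A B) where

    inA? : Decidable (λ r → rim r ∈ A)
    inA? r = rim r ∈? A

    inB? : Decidable (λ r → rim r ∈ B)
    inB? r = rim r ∈? B

    Unmarked : ℕ → ℕ → Set
    Unmarked p q = ∀ {r} → p < r → r < q → rim r ∉ A × rim r ∉ B

    Switch : ℕ → ℕ → Set
    Switch p q = p < q × ((rim p ∈ A × rim q ∈ B) ⊎ (rim p ∈ B × rim q ∈ A)) × Unmarked p q

    -- The segment is oriented from its end in `A` to its end in `B`, whichever comes first on the
    -- rim.
    record SwitchPath (p q : ℕ) : Set where
      field
        {x y}  : Fin m
        {L}    : List (Fin m)
        path   : Path RimEdge x L y
        x∈A    : x ∈ A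
        y∈B    : y ∈ B
        x∈L    : x ∈ˡ L
        y∈L    : y ∈ˡ L
        unique : Unique L
        within : ∀ {w} → w ∈ˡ L → ∃[ r ] (p ≤ r × r ≤ q × w ≡ rim r)
        onlyA  : ∀ {w} → w ∈ˡ L → w ∈ A → w ≡ x
        onlyB  : ∀ {w} → w ∈ˡ L → w ∈ B → w ≡ y
        par    : parity (length L) ≡ gap p q ⁻¹

    switchPath : ∀ {p q} → Switch p q → q < p + m → SwitchPath p q
    switchPath {p} {q} (p<q , ends , unmarked) q< = build ends
      where
      p≤q = ℕ.<⇒≤ p<q
      path : Path RimEdge (rim p) (segment p q) (rim q)
      path = segment-path p≤q
      within : ∀ {w} → w ∈ˡ segment p q → ∃[ r ] (p ≤ r × r ≤ q × w ≡ rim r)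
      within = ∈-segment p≤q
      onlyEnds : ∀ {w} → w ∈ˡ segment p q → w ∈ A ⊎ w ∈ B → w ≡ rim p ⊎ w ≡ rim q
      onlyEnds = ∈-segment-ends p≤q λ p<r r<q → Sum.[ proj₁ (unmarked p<r r<q) , proj₂ (unmarked p<r r<q) ]
      build : (rim p ∈ A × rim q ∈ B) ⊎ (rim p ∈ B × rim q ∈ A) → SwitchPath p q
      build (inj₁ (p∈A , q∈B)) = record
        { path = path ; x∈A = p∈A ; y∈B = q∈B ; x∈L = path-head∈ path ; y∈L = path-last∈ path
        ; unique = segment-unique p≤q q< ; within = within
        ; onlyA = λ w∈ w∈A → case onlyEnds w∈ (inj₁ w∈A) of λ where
            (inj₁ eq)   → eq
            (inj₂ refl) → contradiction q∈B (A#B _ w∈A)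
        ; onlyB = λ w∈ w∈B → case onlyEnds w∈ (inj₂ w∈B) of λ where
            (inj₁ refl) → contradiction w∈B (A#B _ p∈A)
            (inj₂ eq)   → eq
        ; par = segment-parity p≤q }
      build (inj₂ (p∈B , q∈A)) = record
        { path = path-reverse RimEdge-sym path ; x∈A = q∈A ; y∈B = p∈B
        ; x∈L = Any.reverse⁺ (path-last∈ path) ; y∈L = Any.reverse⁺ (path-head∈ path)
        ; unique = unique-reverse (segment-unique p≤q q<) ; within = within ∘ Any.reverse⁻
        ; onlyA = λ w∈ w∈A → case onlyEnds (Any.reverse⁻ w∈) (inj₁ w∈A) of λ where
            (inj₁ refl) → contradiction p∈B (A#B _ w∈A)
            (inj₂ eq)   → eq
        ; onlyB = λ w∈ w∈B → case onlyEnds (Any.reverse⁻ w∈) (inj₂ w∈B) of λ where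
            (inj₁ eq)   → eq
            (inj₂ refl) → contradiction w∈B (A#B _ q∈A)
        ; par = trans (cong parity (List.length-reverse (segment p q))) (segment-parity p≤q) }

    -- The bounds keep the two segments disjoint within one turn, so `two-chord-cycle` applies to
    -- the first and the reverse of the second.
    switches-agree : ∀ {p q p′ q′} → Switch p q → Switch p′ q′ → q < p′ → q′ < p + m → gap p q ≡ gap p′ q′
    switches-agree {p} {q} {p′} {q′} s@(p<q , _) s′@(p′<q′ , _) q<p′ q′<p+m = ⁻¹-+-⁻¹≡0 (trans
        (cong₂ ℙ._+_ (≡-sym (S.par)) (trans (≡-sym S′.par) (cong parity (≡-sym (List.length-reverse S′.L)))))
        (two-chord-cycle inA inB S.path (path-reverse RimEdge-sym S′.path) S.x∈A S′.x∈A S.y∈B S′.y∈B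
          (λ eq → apart S.x∈L S′.x∈L eq) (λ eq → apart S.y∈L S′.y∈L eq)
          (Unique.++⁺ S.unique (unique-reverse S′.unique) (λ { (w∈ , w∈′) → apart w∈ (Any.reverse⁻ w∈′) refl }))
          (λ w∈ w∈A → Sum.map (λ z → S.onlyA z w∈A) (λ z → S′.onlyA (Any.reverse⁻ z) w∈A) (∈-++⁻ S.L w∈))
          (λ w∈ w∈B → Sum.map (λ z → S.onlyB z w∈B) (λ z → S′.onlyB (Any.reverse⁻ z) w∈B) (∈-++⁻ S.L w∈))))
      where
      p<p′ = ℕ.<-trans p<q q<p′
      module S  = SwitchPath (switchPath s (ℕ.<-trans q<p′ (ℕ.<-trans p′<q′ q′<p+m)))
      module S′ = SwitchPath (switchPath s′ (ℕ.<-trans q′<p+m (ℕ.+-monoˡ-< m p<p′)))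
      apart : ∀ {w w′} → w ∈ˡ S.L → w′ ∈ˡ S′.L → w ≢ w′
      apart w∈ w∈′ eq with S.within w∈ | S′.within w∈′
      ... | r , p≤r , r≤q , refl | r′ , p′≤r′ , r′≤q′ , refl =
        rim-injective (ℕ.≤-<-trans r≤q (ℕ.<-≤-trans q<p′ p′≤r′))
          (ℕ.≤-<-trans r′≤q′ (ℕ.<-≤-trans q′<p+m (ℕ.+-monoˡ-≤ m p≤r))) eq

    A≢B : ∀ {r s} → rim r ∈ A → rim s ∈ B → r ≢ s
    A≢B r∈A s∈B refl = A#B _ r∈A s∈B

    other-position : ∀ {K x} p → x ∈ K → x ≢ rim p → ∃[ r ] (p < r × r < p + m × rim r ≡ x)
    other-position p x∈ x≢ with rim-surjective p _
    ... | r , p≤r , r< , eq = r , ℕ.≤∧≢⇒< p≤r (λ { refl → x≢ (≡-sym eq) }) , r< , eq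

    -- The cyclic order is b < a < b′ ≤ b₂ < a₂ < a₀ < b₀ ≤ b + m. The switches (b, a) and (a, b′) have
    -- different parities, yet are linked by the chain (b, a), (b₂, a₂), (a₀, b₀), (a, b′) of disjoint pairs.
    no-isolated-A : ∀ {b a b′} → b < a → a < b′ → rim b ∈ B → rim a ∈ A → rim b′ ∈ B →
      Unmarked b a → Unmarked a b′ → ⊥
    no-isolated-A {b} {a} {b′} b<a a<b′ b∈ a∈ b′∈ unm unm′
      with first-after inA? (ℕ.m<m+n a (>-nonZero⁻¹ m)) (rim-period-∈ a∈)
         | last-before inA? (ℕ.m<m+n a (>-nonZero⁻¹ m)) a∈
    ... | a₂ , a<a₂ , _ , a₂∈ , no-a₂ | a₀ , _ , a₀<a+m , a₀∈ , no-a₀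
      with last-before inB? b′<a₂ b′∈ | first-after inB? a₀<b+m (rim-period-∈ b∈)
      where
      b′<a₂ : b′ < a₂
      b′<a₂ with ℕ.<-cmp b′ a₂
      ... | tri< lt _ _ = lt
      ... | tri≈ _ eq _ = contradiction (≡-sym eq) (A≢B a₂∈ b′∈)
      ... | tri> _ _ gt = contradiction a₂∈ (proj₁ (unm′ a<a₂ gt))
      a₀<b+m : a₀ < b + m
      a₀<b+m with ℕ.<-cmp a₀ (b + m)
      ... | tri< lt _ _ = lt
      ... | tri≈ _ eq _ = contradiction eq (A≢B a₀∈ (rim-period-∈ b∈))
      ... | tri> _ _ gt = contradiction (rim-period-∈⁻ (subst (λ z → rim z ∈ A) (≡-sym a₀≡) a₀∈)) (proj₁ (unm b< <a))
        where
        a₀≡ : a₀ ∸ m + m ≡ a₀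
        a₀≡ = ℕ.m∸n+n≡m (ℕ.≤-trans (ℕ.m≤n+m m b) (ℕ.<⇒≤ gt))
        b< : b < a₀ ∸ m
        b< = ℕ.+-cancelʳ-< m _ _ (subst (b + m <_) (≡-sym a₀≡) gt)
        <a : a₀ ∸ m < a
        <a = ℕ.+-cancelʳ-< m _ _ (subst (_< a + m) (≡-sym a₀≡) a₀<a+m)
    ... | b₂ , b′≤b₂ , b₂<a₂ , b₂∈ , no-b₂ | b₀ , a₀<b₀ , b₀≤b+m , b₀∈ , no-b₀ = contradiction
      (trans (≡-sym (odd-gap inB (ℕ.<-trans b<a a<b′) b∈ b′∈ no-b))
        (solve (parity b) (parity a) (parity b′) (trans ba≡b₂a₂ (trans b₂a₂≡a₀b₀ (≡-sym ab′≡a₀b₀)))))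
      λ ()
      where
      a₂<a₀ : a₂ < a₀
      -- A third member of `A`, besides `a` and `a₂`, lies after `a₂` and not after `a₀`.
      a₂<a₀ with third inA a∈ a₂∈
      ... | w , w∈ , w≢a , w≢a₂ with other-position a w∈ w≢a
      ...   | r , a<r , r< , refl = ℕ.<-≤-trans
        (ℕ.≤∧≢⇒< (ℕ.≮⇒≥ λ r<a₂ → no-a₂ a<r r<a₂ w∈) λ { refl → w≢a₂ refl })
        (ℕ.≮⇒≥ λ a₀<r → no-a₀ a₀<r r< w∈)
      b<b₂ : b < b₂
      b<b₂ = ℕ.<-≤-trans (ℕ.<-trans b<a a<b′) b′≤b₂
      a<b₂ : a < b₂
      a<b₂ = ℕ.<-≤-trans a<b′ b′≤b₂
      ba : Switch b a
      ba = b<a , inj₂ (b∈ , a∈) , unm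
      ab′ : Switch a b′
      ab′ = a<b′ , inj₁ (a∈ , b′∈) , unm′
      b₂a₂ : Switch b₂ a₂
      b₂a₂ = b₂<a₂ , inj₂ (b₂∈ , a₂∈) , λ b₂<r r<a₂ → no-a₂ (ℕ.<-trans a<b₂ b₂<r) r<a₂ , no-b₂ b₂<r r<a₂
      a₀b₀ : Switch a₀ b₀
      a₀b₀ = a₀<b₀ , inj₁ (a₀∈ , b₀∈) , λ a₀<r r<b₀ →
        no-a₀ a₀<r (ℕ.<-trans r<b₀ (ℕ.≤-<-trans b₀≤b+m (ℕ.+-monoˡ-< m b<a))) , no-b₀ a₀<r r<b₀
      ba≡b₂a₂ = switches-agree ba b₂a₂ a<b₂ (ℕ.<-trans a₂<a₀ (ℕ.<-≤-trans a₀<b₀ b₀≤b+m))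
      b₂a₂≡a₀b₀ = switches-agree b₂a₂ a₀b₀ a₂<a₀ (ℕ.≤-<-trans b₀≤b+m (ℕ.+-monoˡ-< m b<b₂))
      ab′≡a₀b₀ = switches-agree ab′ a₀b₀ (ℕ.≤-<-trans b′≤b₂ (ℕ.<-trans b₂<a₂ a₂<a₀))
        (ℕ.≤-<-trans b₀≤b+m (ℕ.+-monoˡ-< m b<a))
      no-b : ∀ {r} → b < r → r < b′ → rim r ∉ B
      no-b {r} b<r r<b′ r∈ with ℕ.<-cmp r a
      ... | tri< r<a _ _ = proj₂ (unm b<r r<a) r∈
      ... | tri≈ _ refl _ = A#B _ a∈ r∈
      ... | tri> _ _ a<r = proj₂ (unm′ a<r r<b′) r∈
      solve : ∀ x y z → x ℙ.+ y ≡ y ℙ.+ z → x ℙ.+ z ≡ 0ℙ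
      solve 0ℙ 0ℙ 0ℙ _ = refl
      solve 0ℙ 1ℙ 0ℙ _ = refl
      solve 1ℙ 0ℙ 1ℙ _ = refl
      solve 1ℙ 1ℙ 1ℙ _ = refl

    -- The marked position preceding `q` is in `B`, so `q` opens a run of members of `A`
    -- uninterrupted by `B`.
    BlockStart : ℕ → Set
    BlockStart q = rim q ∈ A × ∃[ b ] (b < q × rim b ∈ B × Unmarked b q)

    -- Each maximal run s … e of A's preceded by b and followed by b′ has e − s odd, because b′ − b is odd
    -- and the switches (b, s), (e, b′) agree; the next run starts at odd distance from e.
    block-starts-even : ∀ {a} → BlockStart a → ∀ n {q} → q < n → a ≤ q → BlockStart q → gap a q ≡ 0ℙ
    block-starts-even {a} start-a@(a∈ , b₀ , b₀<a , b₀∈ , unm₀) (suc n) {q} (s≤s q≤n) a≤q (q∈ , b , b<q , b∈ , unm)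
      with ℕ.m≤n⇒m<n∨m≡n a≤q
    ... | inj₂ refl = p+p≡0 (parity a)
    ... | inj₁ a<q with last-before inA? a<b a∈
      where
      a<b : a < b
      a<b with ℕ.<-cmp a b
      ... | tri< lt _ _ = lt
      ... | tri≈ _ eq _ = contradiction eq (A≢B a∈ b∈)
      ... | tri> _ _ gt = contradiction a∈ (proj₁ (unm gt a<q))
    ...   | e , a≤e , e<b , e∈ , no-e
      with first-after inB? e<b b∈ | last-before inB? (ℕ.<-≤-trans b₀<a a≤e) b₀∈
    ... | b′ , e<b′ , b′≤b , b′∈ , no-b′ | c , b₀≤c , c<e , c∈ , no-c with first-after inA? c<e e∈
    ... | s , c<s , s≤e , s∈ , no-s with ℕ.m≤n⇒m<n∨m≡n s≤e
    -- A run of one vertex is treated apart: its two switches share that vertex, so `switches-agree`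
    -- does not compare them.
    ... | inj₂ refl = ⊥-elim (no-isolated-A c<s e<b′ c∈ s∈ b′∈
            (λ c<r r<s → no-s c<r r<s , no-c c<r r<s)
            (λ e<r r<b′ → no-e e<r (ℕ.<-≤-trans r<b′ b′≤b) , no-b′ e<r r<b′))
    ... | inj₁ s<e = solve (parity a) (parity s) (parity e) (parity q) (parity c) (parity b′) IH e→q c→b′ agree
      where
      c<b′ : c < b′
      c<b′ = ℕ.<-trans c<e e<b′
      no-B : ∀ {r} → c < r → r < b′ → rim r ∉ B
      no-B {r} c<r r<b′ r∈ with ℕ.<-cmp r e
      ... | tri< r<e _ _ = no-c c<r r<e r∈
      ... | tri≈ _ refl _ = A#B _ e∈ r∈
      ... | tri> _ _ e<r = no-b′ e<r r<b′ r∈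
      b′<c+m : b′ < c + m
      -- A second member of `B` lies before `c + m` and not before `b′`, so both switches fit into
      -- one turn.
      b′<c+m with third inB c∈ c∈
      ... | w , w∈ , w≢c , _ with other-position c w∈ w≢c
      ...   | r , c<r , r< , refl = ℕ.≤-<-trans (ℕ.≮⇒≥ λ r<b′ → no-B c<r r<b′ w∈) r<
      cs : Switch c s
      cs = c<s , inj₂ (c∈ , s∈) , λ c<r r<s → no-s c<r r<s , no-c c<r (ℕ.<-trans r<s s<e)
      eb′ : Switch e b′
      eb′ = e<b′ , inj₁ (e∈ , b′∈) , λ e<r r<b′ → no-e e<r (ℕ.<-≤-trans r<b′ b′≤b) , no-b′ e<r r<b′
      agree : gap c s ≡ gap e b′
      agree = switches-agree cs eb′ s<e b′<c+m
      c→b′ : gap c b′ ≡ 1ℙ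
      c→b′ = odd-gap inB c<b′ c∈ b′∈ no-B
      e<q : e < q
      e<q = ℕ.<-trans e<b b<q
      e→q : gap e q ≡ 1ℙ
      e→q = odd-gap inA e<q e∈ q∈ no-A
        where
        no-A : ∀ {r} → e < r → r < q → rim r ∉ A
        no-A {r} e<r r<q r∈ with ℕ.<-cmp r b
        ... | tri< r<b _ _ = no-e e<r r<b r∈
        ... | tri≈ _ refl _ = A#B _ r∈ b∈
        ... | tri> _ _ b<r = proj₁ (unm b<r r<q) r∈
      a≤s : a ≤ s
      a≤s = ℕ.≮⇒≥ λ s<a → proj₁ (unm₀ (ℕ.≤-<-trans b₀≤c c<s) s<a) s∈
      IH : gap a s ≡ 0ℙ
      IH = block-starts-even start-a n (ℕ.<-≤-trans (ℕ.<-trans s<e e<q) q≤n) a≤s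
        (s∈ , c , c<s , c∈ , λ {r} → proj₂ (proj₂ cs) {r})
      solve : ∀ a s e q c b → a ℙ.+ s ≡ 0ℙ → e ℙ.+ q ≡ 1ℙ → c ℙ.+ b ≡ 1ℙ → c ℙ.+ s ≡ e ℙ.+ b → a ℙ.+ q ≡ 0ℙ
      solve 0ℙ 0ℙ 0ℙ 1ℙ 0ℙ 1ℙ _ _ _ ()
      solve 0ℙ 0ℙ 0ℙ 1ℙ 1ℙ 0ℙ _ _ _ ()
      solve 0ℙ 0ℙ 1ℙ 0ℙ _ _ _ _ _ _ = refl
      solve 1ℙ 1ℙ 0ℙ 1ℙ _ _ _ _ _ _ = refl
      solve 1ℙ 1ℙ 1ℙ 0ℙ 0ℙ 1ℙ _ _ _ ()
      solve 1ℙ 1ℙ 1ℙ 0ℙ 1ℙ 0ℙ _ _ _ ()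

    -- A block start `a` recurs at `a + m`; the distance would be even, but it is the odd number
    -- `m`.
    absurd : ⊥
    absurd with proj₁ (proj₂ (proj₁ inB)) | proj₁ (proj₂ (proj₁ inA))
    ... | y , y∈ | x , x∈ with rim-surjective 0 y
    ...   | b₁ , _ , _ , refl with rim-surjective (suc b₁) x
    ...     | a₁ , b₁<a₁ , _ , refl with first-after inA? b₁<a₁ x∈
    ...       | a , b₁<a , _ , a∈ , no-A with last-before inB? b₁<a y∈
    ...         | b , b₁≤b , b<a , b∈ , no-B =
      contradiction
        (trans (≡-sym (block-starts-even (a∈ , b , b<a , b∈ , λ {r} → unm {r}) (suc (a + m)) ℕ.≤-refl (ℕ.m≤m+n a m)
          (rim-period-∈ a∈ , b + m , ℕ.+-monoˡ-< m b<a , rim-period-∈ b∈ , λ {r} → unm+m {r})))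
          (trans (gap-period a a) (cong _⁻¹ (p+p≡0 (parity a)))))
        λ ()
      where
      unm : Unmarked b a
      unm b<r r<a = no-A (ℕ.≤-<-trans b₁≤b b<r) r<a , no-B b<r r<a
      unm+m : Unmarked (b + m) (a + m)
      unm+m {r} b+m<r r<a+m = subst (λ z → rim z ∉ A × rim z ∉ B) r≡
        ((proj₁ (unm b< <a) ∘ rim-period-∈⁻) , (proj₂ (unm b< <a) ∘ rim-period-∈⁻))
        where
        r≡ : r ∸ m + m ≡ r
        r≡ = ℕ.m∸n+n≡m (ℕ.≤-trans (ℕ.m≤n+m m b) (ℕ.<⇒≤ b+m<r))
        b< : b < r ∸ m
        b< = ℕ.+-cancelʳ-< m _ _ (subst (b + m <_) (≡-sym r≡) b+m<r)
        <a : r ∸ m < a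
        <a = ℕ.+-cancelʳ-< m _ _ (subst (_< a + m) (≡-sym r≡) r<a+m)

  -- The vertex common to all inscribed cliques

  Inscribed? : Decidable (Inscribed H)
  Inscribed? K = IsMaxClique? H K ×-dec ¬? (∣ K ∣ ℕ.≟ 2)

  inscribed-meet : ∀ {A B} → Inscribed H A → Inscribed H B → ∃[ x ] (x ∈ A × x ∈ B)
  inscribed-meet {A} {B} inA inB = decidable-stable (any? λ x → (x ∈? A) ×-dec (x ∈? B)) λ ∄x →
    DisjointCliques.absurd inA inB λ x x∈A x∈B → ∄x (x , x∈A , x∈B)

  meet-once : ∀ {A B x y} → Inscribed H A → Inscribed H B → A ≢ B → x ∈ A → x ∈ B → y ∈ A → y ∈ B → x ≡ y
  meet-once (mA , _) (mB , _) A≢B x∈A x∈B y∈A y∈B = maxCliques-meet-once H df mA mB A≢B x∈A y∈A x∈B y∈B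

  _≟ˢ_ : (A B : Subset m) → Dec (A ≡ B)
  _≟ˢ_ = Vec.≡-dec Bool._≟_

  -- Without inscribed cliques any vertex serves, with a single one any of its members. Two distinct
  -- ones determine the vertex, and it must be found in all others.
  common-vertex : ∃[ ξ ] (∀ A → Inscribed H A → ξ ∈ A)
  common-vertex with anySubset? Inscribed?
  ... | no ∄A = rim 0 , λ A inA → contradiction (A , inA) ∄A
  ... | yes (A , inA) with anySubset? (λ B → Inscribed? B ×-dec ¬? (A ≟ˢ B))
  ...   | no ∄B = let x , x∈ = proj₁ (proj₂ (proj₁ inA)) in
          x , λ B inB → subst (x ∈_) (decidable-stable (A ≟ˢ B) λ A≢B → ∄B (B , inB , A≢B)) x∈
  ...   | yes (B , inB , A≢B) with inscribed-meet inA inB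
  ...     | ξ , ξ∈A , ξ∈B = ξ , λ D inD → decidable-stable (ξ ∈? D) (on-every D inD)
    where
    -- Otherwise D meets A in x and B in y, and xyξ is a triangle with xξ in A, hence y in A.
    on-every : ∀ D → Inscribed H D → ¬ (ξ ∉ D)
    on-every D inD ξ∉D with inscribed-meet inA inD | inscribed-meet inB inD
    ... | x , x∈A , x∈D | y , y∈B , y∈D = ≢ξ y∈D
          (meet-once inA inB A≢B y∈A y∈B ξ∈A ξ∈B)
      where
      ≢ξ : ∀ {z} → z ∈ D → z ≢ ξ
      ≢ξ z∈D refl = ξ∉D z∈D
      y∈A : y ∈ A
      y∈A with y Fin.≟ x
      ... | yes refl = x∈A
      ... | no y≢x   = common-neighbour∈ H df (proj₁ inA) x∈A ξ∈A (≢ξ x∈D)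
              (proj₁ (proj₁ inD) y x y∈D x∈D y≢x) (proj₁ (proj₁ inB) y ξ y∈B ξ∈B (≢ξ y∈D))

  -- The N-conditions along rim paths

  module OnRim (P : RimPath m) where

    -- The path occupies the positions `p` to `q`, with `q` unreduced because the path may cross the
    -- label 0.
    p q : ℕ
    p = toℕ (start P)
    q = suc (k P) + p

    p<q : p < q
    p<q = s≤s (ℕ.m≤n+m p (k P))

    p≤q : p ≤ q
    p≤q = ℕ.<⇒≤ p<q

    q<p+m : q < p + m
    q<p+m = subst (q <_) (ℕ.+-comm m p) (ℕ.+-monoˡ-≤ p (injective⇒≤ (inj P)))

    vtx-at : ∀ i (i< : i < 2 + k P) → vtx P (fromℕ< i<) ≡ rim (i + p)
    vtx-at zero    i<       = ≡-sym (rim-toℕ (start P))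
    vtx-at (suc i) i+1<@(s≤s i<) = RimSucc-functional
      (subst (λ z → RimSucc m z (vtx P (fromℕ< i+1<))) (vtx-at i (ℕ.m≤n⇒m≤1+n i<))
        (step P _ _ (trans (cong suc (toℕ-fromℕ< (ℕ.m≤n⇒m≤1+n i<))) (≡-sym (toℕ-fromℕ< i+1<)))))
      (rim-step (i + p))

    start≡ : start P ≡ rim p
    start≡ = ≡-sym (rim-toℕ (start P))

    end≡ : end P ≡ rim q
    end≡ = trans (cong (vtx P) (toℕ-injective (trans (Fin.toℕ-fromℕ (suc (k P))) (≡-sym (toℕ-fromℕ< ℕ.≤-refl)))))
      (vtx-at (suc (k P)) ℕ.≤-refl)

    internal : ∀ {r} → p < r → r < q → Internal P (rim r)
    internal {r} p<r r<q = fromℕ< i< ,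
      subst (0 <_) (≡-sym (toℕ-fromℕ< i<)) (ℕ.m<n⇒0<n∸m p<r) ,
      subst (_< suc (k P)) (≡-sym (toℕ-fromℕ< i<)) i<1+k ,
      trans (vtx-at (r ∸ p) i<) (cong rim r≡)
      where
      r≡ : r ∸ p + p ≡ r
      r≡ = ℕ.m∸n+n≡m (ℕ.<⇒≤ p<r)
      i<1+k : r ∸ p < suc (k P)
      i<1+k = ℕ.+-cancelʳ-< p _ _ (subst (_< q) (≡-sym r≡) r<q)
      i< : r ∸ p < 2 + k P
      i< = ℕ.m≤n⇒m≤1+n i<1+k

    nverts-parity : parity (nverts P) ≡ gap p q ⁻¹
    nverts-parity = trans (parity-suc (suc (k P)))
      (cong _⁻¹ (trans (cong parity (≡-sym (ℕ.m+n∸n≡m (suc (k P)) p))) (gap-∸ p≤q)))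

  -- This serves `H` and its sub-multisuns alike. A path clean in `H′` may run through deleted
  -- cliques, so the lemmas used here only ask it to avoid the one or two cliques concerned.
  module Inherited (H′ : Graph m) (inscribed : ∀ {K} → Inscribed H′ K → Inscribed H K) where

    clean-unmarked : ∀ {A} → Inscribed H′ A → ∀ P → Clean H′ P → let open OnRim P in
      ∀ {r} → p < r → r < q → rim r ∉ A
    clean-unmarked inA P clean p<r r<q = clean _ (OnRim.internal P p<r r<q) _ inA

    -- The odd gap makes the number of vertices even, and two vertices would be a rim edge inside
    -- `A`.
    n1 : N1 H′
    n1 A inA P clean joins = parity≡0⇒Even (nverts P) even , at-least-four P even consecutive
      where
      open OnRim P
      p∈ : rim p ∈ A
      p∈ = subst (_∈ A) start≡ (proj₁ (Sum.reduce joins))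
      q∈ : rim q ∈ A
      q∈ = subst (_∈ A) end≡ (proj₂ (Sum.reduce joins))
      even : parity (nverts P) ≡ 0ℙ
      even = trans nverts-parity (cong _⁻¹ (odd-gap (inscribed inA) p<q p∈ q∈ (clean-unmarked inA P clean)))
      consecutive : k P ≢ 0
      consecutive k≡0 = nonconsecutive (inscribed inA) p∈ q∈
        (subst (λ z → RimSucc m (rim p) (rim (suc z + p))) (≡-sym k≡0) (rim-step p))
      at-least-four : ∀ P → parity (nverts P) ≡ 0ℙ → k P ≢ 0 → 4 ≤ nverts P
      at-least-four P even k≢0 with k P
      ... | zero        = contradiction refl k≢0
      ... | suc zero    = contradiction even λ ()
      ... | suc (suc _) = s≤s (s≤s (s≤s (s≤s z≤n)))

    n5-directed : ∀ {A B} → Inscribed H′ A → Inscribed H′ B → ∀ P → Clean H′ P →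
      start P ∈ A → start P ∉ B → end P ∈ B → end P ∉ A → Odd (nverts P)
    n5-directed {A} {B} inA inB P clean s∈A s∉B e∈B e∉A with inscribed-meet (inscribed inA) (inscribed inB)
    ... | ξ , ξ∈A , ξ∈B = parity≡1⇒Odd (nverts P) (trans nverts-parity (trans (≡-sym (segment-parity p≤q)) odd))
      where
      open OnRim P
      at-end : ∀ {w} → w ∈ˡ segment p q → w ∈ A ⊎ w ∈ B → w ≡ rim p ⊎ w ≡ rim q
      at-end = ∈-segment-ends p≤q λ p<r r<q →
        Sum.[ clean-unmarked inA P clean p<r r<q , clean-unmarked inB P clean p<r r<q ]
      onlyA : ∀ {w} → w ∈ˡ segment p q → w ∈ A → w ≡ rim p
      onlyA w∈ w∈A with at-end w∈ (inj₁ w∈A)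
      ... | inj₁ eq   = eq
      ... | inj₂ refl = contradiction (subst (_∈ A) (≡-sym end≡) w∈A) e∉A
      onlyB : ∀ {w} → w ∈ˡ segment p q → w ∈ B → w ≡ rim q
      onlyB w∈ w∈B with at-end w∈ (inj₂ w∈B)
      ... | inj₁ refl = contradiction (subst (_∈ B) (≡-sym start≡) w∈B) s∉B
      ... | inj₂ eq   = eq
      ξ∉ : ξ ∉ˡ segment p q
      -- Lying in both cliques, `ξ` would have to be both ends of the segment.
      ξ∉ ξ∈ = rim-injective p<q q<p+m (trans (≡-sym (onlyA ξ∈ ξ∈A)) (onlyB ξ∈ ξ∈B))
      odd : parity (length (segment p q)) ≡ 1ℙ
      odd = odd-path-between-cliques (inscribed inA) (inscribed inB) ξ∈A ξ∈B (segment-path p≤q) (segment-unique p≤q q<p+m)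
        (subst (_∈ A) start≡ s∈A) (subst (_∈ B) end≡ e∈B) ξ∉
        (path-head∈ (segment-path p≤q)) (path-last∈ (segment-path p≤q)) onlyA onlyB

    nConditions : NConditions H′
    nConditions = n1 , (λ A inA → odd-size (inscribed inA)) , (ξ , ((λ A inA → ξ∈ A (inscribed inA)) , n3) , n4) , n5
      where
      ξ  = proj₁ common-vertex
      ξ∈ = proj₂ common-vertex
      n3 : ∀ A B → Inscribed H′ A → Inscribed H′ B → A ≢ B → ∀ x → x ∈ A → x ∈ B → x ≡ ξ
      n3 A B inA inB A≢B x x∈A x∈B =
        meet-once (inscribed inA) (inscribed inB) A≢B x∈A x∈B (ξ∈ A (inscribed inA)) (ξ∈ B (inscribed inB))
      n4 : N4 H′ ξ
      -- Since `ξ` lies in `A`, the path joins `A` to itself.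
      n4 A inA P clean joins = proj₁ (n1 A inA P clean (Sum.map
        (λ (s∈ , e≡ξ) → s∈ , subst (_∈ A) (≡-sym e≡ξ) (ξ∈ A (inscribed inA)))
        (λ (s≡ξ , e∈) → subst (_∈ A) (≡-sym s≡ξ) (ξ∈ A (inscribed inA)) , e∈) joins))
      n5 : N5 H′
      n5 A B inA inB A≢B P clean (inj₁ ((s∈A , s∉B) , (e∈B , e∉A))) = n5-directed inA inB P clean s∈A s∉B e∈B e∉A
      n5 A B inA inB A≢B P clean (inj₂ ((s∈B , s∉A) , (e∈A , e∉B))) = n5-directed inB inA P clean s∈B s∉A e∈A e∉B

  -- Deletion of inscribed cliques

  module Deletion (D : List (Subset m)) (D-inscribed : All (Inscribed H) D) where

    H-D : Graph m
    H-D = deleteCliques H D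

    kept-edge : ∀ {x y} → Edge H x y → ¬ Any (λ K → x ∈ K × y ∈ K) D → Edge H-D x y
    kept-edge {x} {y} e ∄K = cong₂ (λ a b → a ∧ not b) e (inSome-false x y ∄K)

    kept-edge⁻ : ∀ {x y} → Edge H-D x y → Edge H x y × ¬ Any (λ K → x ∈ K × y ∈ K) D
    kept-edge⁻ {x} {y} e with adj H x y | inSome D x y in eq
    ... | true | false = refl , λ any → contradiction (trans (≡-sym eq) (inSome-true x y any)) λ ()

    -- No deleted clique contains two consecutive rim vertices.
    rim-kept : ∀ x → Edge H-D (next x) x
    rim-kept x = kept-edge (rim-neighbour x) λ any →
      case All.lookupWith (λ inK (n∈ , x∈) → nonconsecutive inK x∈ n∈ (next-succ x)) D-inscribed any of λ ()

    -- Let `T` be a clique of `H` containing `K`. A deleted clique through two vertices of `T` would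
    -- absorb `K` and with it the edge `uv`, which was kept. So `T` survives the deletion, and
    -- maximality of `K` applies.
    H-D-inscribed : ∀ {K} → Inscribed H-D K → Inscribed H K
    H-D-inscribed {K} (mK@(clq , (u , u∈) , max) , size) with maxClique-second H-D mK u∈ (rim-kept u)
    ... | v , v∈ , v≢u = ((λ x y x∈ y∈ x≢y → proj₁ (kept-edge⁻ (clq x y x∈ y∈ x≢y))) , (u , u∈) , max′) , size
      where
      max′ : ∀ T → IsClique H T → K ⊆ T → T ⊆ K
      max′ T clqT K⊆T = max T clqT′ K⊆T
        where
        clqT′ : IsClique H-D T
        clqT′ x y x∈ y∈ x≢y = kept-edge (clqT x y x∈ y∈ x≢y) λ any →
          proj₂ (kept-edge⁻ (clq u v u∈ v∈ (v≢u ∘ ≡-sym)))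
            (absorbed D-inscribed any)
          where
          absorbs : ∀ {K′ z} → Inscribed H K′ → x ∈ K′ → y ∈ K′ → z ∈ K → z ∈ K′
          absorbs {z = z} (mK′ , _) x∈′ y∈′ z∈ with z Fin.≟ x | z Fin.≟ y
          ... | yes refl | _        = x∈′
          ... | no _     | yes refl = y∈′
          ... | no z≢x   | no z≢y   = common-neighbour∈ H df mK′ x∈′ y∈′ x≢y
                  (clqT z x (K⊆T z∈) x∈ z≢x) (clqT z y (K⊆T z∈) y∈ z≢y)
          absorbed : ∀ {D} → All (Inscribed H) D → Any (λ K → x ∈ K × y ∈ K) D → Any (λ K → u ∈ K × v ∈ K) D
          absorbed (inK′ ∷ _) (here (x∈′ , y∈′)) = here (absorbs inK′ x∈′ y∈′ u∈ , absorbs inK′ x∈′ y∈′ v∈)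
          absorbed (_ ∷ rest) (there any)        = there (absorbed rest any)

  sunoid : Odd m → 3 ≤ m → IsSunoid H
  sunoid odd 3≤m = (df , odd , 3≤m , rim-cliques , inscribed-nonconsecutive) ,
    Inherited.nConditions H id ,
    λ D D-inscribed _ → Inherited.nConditions (deleteCliques H D) (Deletion.H-D-inscribed D D-inscribed)
    where
    rim-max : ∀ {x y} → RimAdj m x y → IsMaxClique H (⁅ x ⁆ ∪ ⁅ y ⁆)
    rim-max (inj₁ s) = let e , none = rim-proper s in pair-maxClique H e none
    rim-max (inj₂ s) = let e , none = RimEdge-sym (rim-proper s) in pair-maxClique H e none
    rim-cliques : ∀ x y → x ≢ y →
      (IsMaxClique H (⁅ x ⁆ ∪ ⁅ y ⁆) → RimAdj m x y) × (RimAdj m x y → IsMaxClique H (⁅ x ⁆ ∪ ⁅ y ⁆))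
    rim-cliques x y x≢y = two-element-cliques-on-rim x y x≢y , rim-max
    inscribed-nonconsecutive : ∀ K → IsMaxClique H K → ∣ K ∣ ≢ 2 → ∀ x y → x ∈ K → y ∈ K → ¬ RimAdj m x y
    inscribed-nonconsecutive K mK size x y x∈ y∈ (inj₁ s) = nonconsecutive (mK , size) x∈ y∈ s
    inscribed-nonconsecutive K mK size x y x∈ y∈ (inj₂ s) = nonconsecutive (mK , size) y∈ x∈ s

-- From proper odd cycles to sunoids, and the equivalence

properOddCycle⇒3≤length : (G : Graph n) → ∀ {L} → ProperOddCycle G L → 3 ≤ length L
properOddCycle⇒3≤length G (u , _ , ⟨ _ ⟩ , (e , _) , _) = contradiction refl (Edge⇒≢ G e)
-- Two adjacent vertices are excluded by parity.
properOddCycle⇒3≤length G (_ , _ , _ ∷ ⟨ _ ⟩ , _ , _ , ())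
properOddCycle⇒3≤length G (_ , _ , _ ∷ (_ ∷ ⟨ _ ⟩) , _) = s≤s (s≤s (s≤s z≤n))
properOddCycle⇒3≤length G (_ , _ , _ ∷ (_ ∷ (_ ∷ _)) , _) = s≤s (s≤s (s≤s z≤n))

-- Induction on the length: once shorter proper odd cycles are excluded, the cycle is shortest and
-- induces a sunoid.
sunoid-free⇒balanced : (G : Graph n) → DiamondFree G → ¬ HasInducedSunoid G → ∀ L → ¬ ProperOddCycle G L
sunoid-free⇒balanced G df sunoid-free L = go (suc (length L)) L ℕ.≤-refl
  where
  go : ∀ bound L → length L < bound → ¬ ProperOddCycle G L
  go (suc bound) L (s≤s len≤) cyc@(u , v , path , close , uniq , odd) =
    sunoid-free (length L , H , ShortestCycle.sunoid {{>-nonZero (ℕ.<-≤-trans (s≤s z≤n) 3≤len)}} H df-H odd rim-proper shortest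
      (parity≡1⇒Odd (length L) odd) 3≤len , lookup L , f-inj , λ _ _ → refl)
    where
    3≤len = properOddCycle⇒3≤length G cyc
    f-inj : Injective _≡_ _≡_ (lookup L)
    f-inj = lookup-injective uniq
    H : Graph (length L)
    H = induced G (lookup L)
    df-H : DiamondFree H
    df-H a b c d (a≢b , rest) = df _ _ _ _ (a≢b ∘ f-inj , rest)
    rim-proper : ∀ {x y} → RimSucc (length L) x y → Edge H x y × (∀ w → Edge H w x → Edge H w y → ⊥)
    rim-proper {x} {y} s = let e , none = proper s in e , λ w → none (∈-lookup w)
      where
      proper : RimSucc (length L) x y → Proper G L (lookup L x) (lookup L y)
      proper (inj₁ eq) = path-step path x y eq
      proper (inj₂ (last , first)) = subst (λ z → Proper G L z (lookup L y)) (≡-sym (path-last path x last))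
        (subst (Proper G L v) (≡-sym (path-first path y first)) close)
    shortest : ∀ M → length M < length L → ¬ ProperOddCycle H M
    shortest M M<L cycM = go bound (map (lookup L) M)
      (ℕ.<-≤-trans (subst (_< length L) (≡-sym (List.length-map (lookup L) M)) M<L) len≤)
      (properOddCycle-map G f-inj cycM)

theorem11 : ∀ {n : ℕ} (G : Graph n) → DiamondFree G →
    (CliquePerfect G → ¬ HasInducedOddHole G × ¬ HasInducedSunoid G) ×
    (¬ HasInducedOddHole G × ¬ HasInducedSunoid G → CliquePerfect G)
theorem11 G df =
  (λ cp → cliquePerfect⇒¬oddHole G cp , cliquePerfect⇒¬sunoid G cp) ,
  λ (_ , sunoid-free) → balanced⇒cliquePerfect G df (sunoid-free⇒balanced G df sunoid-free)
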